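{- Let $n,t,\delta$ be integers with $n\ge 3$ and $4\le 2t\le \delta\le \left\lfloor \frac{n+t-1}{2}\right\rfloor$, let $\alpha\in[0,1)$, and let $h=\left\lfloor \frac{n+t-1}{2}\right\rfloor$. Put $$f_0(n,t,\delta,2)=\binom{n+t-\delta}{2}+(\delta-t)\delta,\qquad g_0(n,t,\delta,2)=\binom{n+t-h}{2}+(h-t-1)h+\delta,$$ and $h_0=\max\{f_0(n,t,\delta,2),\,g_0(n,t,\delta,2)\}$. Let $G$ be a finite, simple, connected graph of order $n$ with minimum degree $\delta$. If $$\lambda_\alpha(G)>\frac{\delta+\alpha n-\alpha\delta-1+\sqrt{(\delta+\alpha n-\alpha\delta-1)^2+4(1-\alpha)(2h_0-n\delta+\delta)}}{2},$$ then $G$ is many-to-many $t$-disjoint path coverable.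
   Context: The order of a graph is its number of vertices. For $\alpha\in[0,1)$, $A_\alpha(G)=\alpha D(G)+(1-\alpha)A(G)$, where $A(G)$ is the adjacency matrix and $D(G)$ the diagonal matrix of vertex degrees of $G$; the $\alpha$-spectral radius $\lambda_\alpha(G)$ is the largest eigenvalue of $A_\alpha(G)$. A graph $G$ is many-to-many $t$-disjoint path coverable if for any two disjoint vertex subsets $U=\{u_1,\dots,u_t\}$ and $V=\{v_1,\dots,v_t\}$ of $G$, each consisting of $t$ distinct vertices, there exist a permutation $\tau$ of $\{1,\dots,t\}$ and $t$ paths $P_1,\dots,P_t$ in $G$ such that $P_i$ joins $u_i$ and $v_{\tau(i)}$ and every vertex of $G$ belongs to exactly one of the paths. -}

module Defs where

open import Algebra.Bundles using (CommutativeMonoid; RawMonoid)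
import Algebra.Properties.CommutativeSemigroup as CommutativeSemigroupProperties
open import Data.Fin.Base using (Fin)
import Data.Fin.Properties as Fin
open import Data.Fin.Permutation using (Permutation′; _⟨$⟩ʳ_)
open import Data.Integer.Base using (+_)
open import Data.List.Base using (List; length; filter; allFin; head; last)
open import Data.List.Membership.Propositional using (_∈_)
open import Data.List.Relation.Unary.Linked using (Linked)
open import Data.List.Relation.Unary.Unique.Propositional using (Unique)
open import Data.Maybe.Base using (just)
open import Data.Nat.Base as ℕ using (ℕ)
open import Data.Nat.Combinatorics using (_C_)
import Data.Nat.Properties as ℕ
open import Data.Product.Base using (Σ-syntax; ∃-syntax; _×_; _,_; proj₁; proj₂)
open import Data.Product using (∃!)
open import Data.Rational.Base as ℚ using (ℚ; 0ℚ; 1ℚ; ½; ∣_∣)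
import Data.Rational.Properties as ℚ
open import Data.Vec.Functional using (Vector)
open import Function.Definitions using (Injective)
open import Level using (0ℓ)
open import Relation.Binary.Core using (Rel)
open import Relation.Binary.Construct.Closure.ReflexiveTransitive using (Star)
open import Relation.Binary.Definitions using (Decidable; Symmetric; Irreflexive)
open import Relation.Binary.PropositionalEquality
open import Relation.Nullary.Decidable using (⌊_⌋)
open import Relation.Nullary.Negation using (¬_)
open import Data.Bool.Base using (if_then_else_)

------------------------------------------------------------------------
-- Real numbers: Cauchy sequences of rationals, with setoid equality _≈_

IsCauchy : (ℕ → ℚ) → Set
IsCauchy f = ∀ ε → 0ℚ ℚ.< ε →
  ∃[ N ] (∀ m n → N ℕ.≤ m → N ℕ.≤ n → ∣ f m ℚ.- f n ∣ ℚ.< ε)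

record ℝ : Set where
  constructor mkℝ
  field
    seq    : ℕ → ℚ
    cauchy : IsCauchy seq

open ℝ public

infix 4 _≈_ _<ℝ_ _≤ℝ_

_≈_ : Rel ℝ 0ℓ
x ≈ y = ∀ ε → 0ℚ ℚ.< ε →
  ∃[ N ] (∀ n → N ℕ.≤ n → ∣ seq x n ℚ.- seq y n ∣ ℚ.< ε)

-- The gap ε must be uniform: a termwise _<_ could vanish in the limit.
_<ℝ_ : Rel ℝ 0ℓ
x <ℝ y = Σ[ ε ∈ ℚ ] 0ℚ ℚ.< ε ×
  ∃[ N ] (∀ n → N ℕ.≤ n → seq x n ℚ.+ ε ℚ.≤ seq y n)

_≤ℝ_ : Rel ℝ 0ℓ
x ≤ℝ y = ¬ (y <ℝ x)

private
  difference+ : ∀ p q → p ≡ (p ℚ.- q) ℚ.+ q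
  difference+ p q = begin
    p                       ≡⟨ ℚ.+-identityʳ p ⟨
    p ℚ.+ 0ℚ                ≡⟨ cong (p ℚ.+_) (ℚ.+-inverseˡ q) ⟨
    p ℚ.+ (ℚ.- q ℚ.+ q)     ≡⟨ ℚ.+-assoc p (ℚ.- q) q ⟨
    (p ℚ.- q) ℚ.+ q         ∎
    where open ≡-Reasoning

  sum-difference : ∀ p q r s →
    (p ℚ.+ q) ℚ.- (r ℚ.+ s) ≡ (p ℚ.- r) ℚ.+ (q ℚ.- s)
  sum-difference p q r s = begin
    (p ℚ.+ q) ℚ.- (r ℚ.+ s)
      ≡⟨ cong ((p ℚ.+ q) ℚ.+_) (ℚ.neg-distrib-+ r s) ⟩
    (p ℚ.+ q) ℚ.+ (ℚ.- r ℚ.- s)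
      ≡⟨ interchange p q (ℚ.- r) (ℚ.- s) ⟩
    (p ℚ.- r) ℚ.+ (q ℚ.- s) ∎
    where
    open ≡-Reasoning
    open CommutativeSemigroupProperties
      (CommutativeMonoid.commutativeSemigroup ℚ.+-0-commutativeMonoid) using (interchange)

  product-difference : ∀ p q r s →
    p ℚ.* q ℚ.- r ℚ.* s ≡ p ℚ.* (q ℚ.- s) ℚ.+ s ℚ.* (p ℚ.- r)
  product-difference p q r s = begin
    p ℚ.* q ℚ.- r ℚ.* s
      ≡⟨ cong (ℚ._- r ℚ.* s) (difference+ (p ℚ.* q) (p ℚ.* s)) ⟩
    (p ℚ.* q ℚ.- p ℚ.* s) ℚ.+ p ℚ.* s ℚ.- r ℚ.* s
      ≡⟨ ℚ.+-assoc (p ℚ.* q ℚ.- p ℚ.* s) (p ℚ.* s) (ℚ.- (r ℚ.* s)) ⟩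
    (p ℚ.* q ℚ.- p ℚ.* s) ℚ.+ (p ℚ.* s ℚ.- r ℚ.* s)
      ≡⟨ cong ((p ℚ.* q ℚ.- p ℚ.* s) ℚ.+_)
           (cong₂ ℚ._-_ (ℚ.*-comm p s) (ℚ.*-comm r s)) ⟩
    (p ℚ.* q ℚ.- p ℚ.* s) ℚ.+ (s ℚ.* p ℚ.- s ℚ.* r)
      ≡⟨ cong₂ ℚ._+_ (distrib p q s) (distrib s p r) ⟨
    p ℚ.* (q ℚ.- s) ℚ.+ s ℚ.* (p ℚ.- r) ∎
    where
    open ≡-Reasoning
    distrib : ∀ x y z → x ℚ.* (y ℚ.- z) ≡ x ℚ.* y ℚ.- x ℚ.* z
    distrib x y z = trans (ℚ.*-distribˡ-+ x y (ℚ.- z))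
      (cong (x ℚ.* y ℚ.+_) (sym (ℚ.neg-distribʳ-* x z)))

  half-pos : ∀ {ε} → 0ℚ ℚ.< ε → 0ℚ ℚ.< ½ ℚ.* ε
  half-pos {ε} 0<ε =
    subst (ℚ._< ½ ℚ.* ε) (ℚ.*-zeroʳ ½) (ℚ.*-monoʳ-<-pos ½ 0<ε)

  halves : ∀ ε → ½ ℚ.* ε ℚ.+ ½ ℚ.* ε ≡ ε
  halves ε = trans (sym (ℚ.*-distribʳ-+ ε ½ ½)) (ℚ.*-identityˡ ε)

  module _ (f g : ℕ → ℚ) (cf : IsCauchy f) (cg : IsCauchy g) where

    +-cauchy : IsCauchy (λ n → f n ℚ.+ g n)
    +-cauchy ε 0<ε with cf (½ ℚ.* ε) (half-pos 0<ε) | cg (½ ℚ.* ε) (half-pos 0<ε)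
    ... | N₁ , p | N₂ , q = N₁ ℕ.⊔ N₂ , bound
      where
      open ℚ.≤-Reasoning
      bound : ∀ m n → N₁ ℕ.⊔ N₂ ℕ.≤ m → N₁ ℕ.⊔ N₂ ℕ.≤ n →
              ∣ (f m ℚ.+ g m) ℚ.- (f n ℚ.+ g n) ∣ ℚ.< ε
      bound m n N≤m N≤n = begin-strict
        ∣ (f m ℚ.+ g m) ℚ.- (f n ℚ.+ g n) ∣
          ≡⟨ cong ∣_∣ (sum-difference (f m) (g m) (f n) (g n)) ⟩
        ∣ (f m ℚ.- f n) ℚ.+ (g m ℚ.- g n) ∣
          ≤⟨ ℚ.∣p+q∣≤∣p∣+∣q∣ (f m ℚ.- f n) (g m ℚ.- g n) ⟩
        ∣ f m ℚ.- f n ∣ ℚ.+ ∣ g m ℚ.- g n ∣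
          <⟨ ℚ.+-mono-<
               (p m n (ℕ.m⊔n≤o⇒m≤o N₁ N₂ N≤m) (ℕ.m⊔n≤o⇒m≤o N₁ N₂ N≤n))
               (q m n (ℕ.m⊔n≤o⇒n≤o N₁ N₂ N≤m) (ℕ.m⊔n≤o⇒n≤o N₁ N₂ N≤n)) ⟩
        ½ ℚ.* ε ℚ.+ ½ ℚ.* ε
          ≡⟨ halves ε ⟩
        ε ∎

  -‿cauchy : ∀ f → IsCauchy f → IsCauchy (λ n → ℚ.- f n)
  -‿cauchy f cf ε 0<ε with cf ε 0<ε
  ... | N , p = N , λ m n N≤m N≤n →
    subst (ℚ._< ε)
      (trans (sym (ℚ.∣-p∣≡∣p∣ (f m ℚ.- f n)))
        (cong ∣_∣ (ℚ.neg-distrib-+ (f m) (ℚ.- f n))))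
      (p m n N≤m N≤n)

  eventually-bounded : ∀ f → IsCauchy f →
    Σ[ B ∈ ℚ ] 0ℚ ℚ.< B × ∃[ N ] (∀ n → N ℕ.≤ n → ∣ f n ∣ ℚ.≤ B)
  eventually-bounded f cf with cf 1ℚ (ℚ.positive⁻¹ 1ℚ)
  ... | N , p = 1ℚ ℚ.+ ∣ f N ∣
              , ℚ.+-mono-<-≤ (ℚ.positive⁻¹ 1ℚ) (ℚ.0≤∣p∣ (f N))
              , N , bound
    where
    open ℚ.≤-Reasoning
    bound : ∀ n → N ℕ.≤ n → ∣ f n ∣ ℚ.≤ 1ℚ ℚ.+ ∣ f N ∣
    bound n N≤n = begin
      ∣ f n ∣
        ≡⟨ cong ∣_∣ (difference+ (f n) (f N)) ⟩
      ∣ (f n ℚ.- f N) ℚ.+ f N ∣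
        ≤⟨ ℚ.∣p+q∣≤∣p∣+∣q∣ (f n ℚ.- f N) (f N) ⟩
      ∣ f n ℚ.- f N ∣ ℚ.+ ∣ f N ∣
        ≤⟨ ℚ.+-monoˡ-≤ ∣ f N ∣ (ℚ.<⇒≤ (p n N N≤n ℕ.≤-refl)) ⟩
      1ℚ ℚ.+ ∣ f N ∣ ∎

  *-cauchy : ∀ f g → IsCauchy f → IsCauchy g → IsCauchy (λ n → f n ℚ.* g n)
  *-cauchy f g cf cg ε 0<ε
    with eventually-bounded f cf | eventually-bounded g cg
  ... | B , 0<B , N₁ , f≤B | K , 0<K , N₂ , g≤K = N , bound
    where
    instance
      B-pos : ℚ.Positive B
      B-pos = ℚ.positive 0<B
      K-pos : ℚ.Positive K
      K-pos = ℚ.positive 0<K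
      D-pos : ℚ.Positive (B ℚ.+ K)
      D-pos = ℚ.positive (ℚ.+-mono-< 0<B 0<K)
      D-nonZero : ℚ.NonZero (B ℚ.+ K)
      D-nonZero = ℚ.pos⇒nonZero (B ℚ.+ K)
      D⁻¹-pos : ℚ.Positive (ℚ.1/ (B ℚ.+ K))
      D⁻¹-pos = ℚ.1/pos⇒pos (B ℚ.+ K)

    δ : ℚ
    δ = (ℚ.1/ (B ℚ.+ K)) ℚ.* ε

    0<δ : 0ℚ ℚ.< δ
    0<δ = subst (ℚ._< δ) (ℚ.*-zeroʳ (ℚ.1/ (B ℚ.+ K)))
            (ℚ.*-monoʳ-<-pos (ℚ.1/ (B ℚ.+ K)) 0<ε)

    [B+K]δ≡ε : B ℚ.* δ ℚ.+ K ℚ.* δ ≡ ε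
    [B+K]δ≡ε = begin
      B ℚ.* δ ℚ.+ K ℚ.* δ                      ≡⟨ ℚ.*-distribʳ-+ δ B K ⟨
      (B ℚ.+ K) ℚ.* δ                          ≡⟨ ℚ.*-assoc (B ℚ.+ K) (ℚ.1/ (B ℚ.+ K)) ε ⟨
      ((B ℚ.+ K) ℚ.* (ℚ.1/ (B ℚ.+ K))) ℚ.* ε   ≡⟨ cong (ℚ._* ε) (ℚ.*-inverseʳ (B ℚ.+ K)) ⟩
      1ℚ ℚ.* ε                                 ≡⟨ ℚ.*-identityˡ ε ⟩
      ε                                        ∎
      where open ≡-Reasoning

    term : ∀ b b′ c .{{_ : ℚ.Positive b′}} →
           ∣ b ∣ ℚ.≤ b′ → ∣ c ∣ ℚ.< δ → ∣ b ℚ.* c ∣ ℚ.< b′ ℚ.* δ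
    term b b′ c b≤b′ c<δ = begin-strict
      ∣ b ℚ.* c ∣        ≡⟨ ℚ.∣p*q∣≡∣p∣*∣q∣ b c ⟩
      ∣ b ∣ ℚ.* ∣ c ∣    ≤⟨ ℚ.*-monoʳ-≤-nonNeg ∣ c ∣ {{ℚ.nonNegative (ℚ.0≤∣p∣ c)}} b≤b′ ⟩
      b′ ℚ.* ∣ c ∣       <⟨ ℚ.*-monoʳ-<-pos b′ c<δ ⟩
      b′ ℚ.* δ           ∎
      where open ℚ.≤-Reasoning

    N₃ = proj₁ (cf δ 0<δ)
    N₄ = proj₁ (cg δ 0<δ)
    N  = (N₁ ℕ.⊔ N₂) ℕ.⊔ (N₃ ℕ.⊔ N₄)

    bound : ∀ m n → N ℕ.≤ m → N ℕ.≤ n → ∣ f m ℚ.* g m ℚ.- f n ℚ.* g n ∣ ℚ.< ε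
    bound m n N≤m N≤n = begin-strict
      ∣ f m ℚ.* g m ℚ.- f n ℚ.* g n ∣
        ≡⟨ cong ∣_∣ (product-difference (f m) (g m) (f n) (g n)) ⟩
      ∣ f m ℚ.* (g m ℚ.- g n) ℚ.+ g n ℚ.* (f m ℚ.- f n) ∣
        ≤⟨ ℚ.∣p+q∣≤∣p∣+∣q∣ (f m ℚ.* (g m ℚ.- g n)) (g n ℚ.* (f m ℚ.- f n)) ⟩
      ∣ f m ℚ.* (g m ℚ.- g n) ∣ ℚ.+ ∣ g n ℚ.* (f m ℚ.- f n) ∣
        <⟨ ℚ.+-mono-<
             (term (f m) B (g m ℚ.- g n) (f≤B m (N₁≤ N≤m))
               (proj₂ (cg δ 0<δ) m n (N₄≤ N≤m) (N₄≤ N≤n)))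
             (term (g n) K (f m ℚ.- f n) (g≤K n (N₂≤ N≤n))
               (proj₂ (cf δ 0<δ) m n (N₃≤ N≤m) (N₃≤ N≤n))) ⟩
      B ℚ.* δ ℚ.+ K ℚ.* δ
        ≡⟨ [B+K]δ≡ε ⟩
      ε ∎
      where
      open ℚ.≤-Reasoning
      N₁≤ : ∀ {k} → N ℕ.≤ k → N₁ ℕ.≤ k
      N₁≤ p = ℕ.m⊔n≤o⇒m≤o N₁ N₂ (ℕ.m⊔n≤o⇒m≤o (N₁ ℕ.⊔ N₂) (N₃ ℕ.⊔ N₄) p)
      N₂≤ : ∀ {k} → N ℕ.≤ k → N₂ ℕ.≤ k
      N₂≤ p = ℕ.m⊔n≤o⇒n≤o N₁ N₂ (ℕ.m⊔n≤o⇒m≤o (N₁ ℕ.⊔ N₂) (N₃ ℕ.⊔ N₄) p)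
      N₃≤ : ∀ {k} → N ℕ.≤ k → N₃ ℕ.≤ k
      N₃≤ p = ℕ.m⊔n≤o⇒m≤o N₃ N₄ (ℕ.m⊔n≤o⇒n≤o (N₁ ℕ.⊔ N₂) (N₃ ℕ.⊔ N₄) p)
      N₄≤ : ∀ {k} → N ℕ.≤ k → N₄ ℕ.≤ k
      N₄≤ p = ℕ.m⊔n≤o⇒n≤o N₃ N₄ (ℕ.m⊔n≤o⇒n≤o (N₁ ℕ.⊔ N₂) (N₃ ℕ.⊔ N₄) p)

fromℚ : ℚ → ℝ
fromℚ q .seq    _     = q
fromℚ q .cauchy ε 0<ε = 0 , λ _ _ _ _ →
  subst (λ p → ∣ p ∣ ℚ.< ε) (sym (ℚ.+-inverseʳ q)) 0<ε

fromℕ : ℕ → ℝ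
fromℕ k = fromℚ (+ k ℚ./ 1)

0ℝ 1ℝ ½ℝ : ℝ
0ℝ = fromℚ 0ℚ
1ℝ = fromℚ 1ℚ
½ℝ = fromℚ ½

infixl 7 _*ℝ_
infixl 6 _+ℝ_ _-ℝ_

_+ℝ_ _*ℝ_ _-ℝ_ : ℝ → ℝ → ℝ
(x +ℝ y) .seq n  = seq x n ℚ.+ seq y n
(x +ℝ y) .cauchy = +-cauchy (seq x) (seq y) (cauchy x) (cauchy y)
(x *ℝ y) .seq n  = seq x n ℚ.* seq y n
(x *ℝ y) .cauchy = *-cauchy (seq x) (seq y) (cauchy x) (cauchy y)
(x -ℝ y) .seq n  = seq x n ℚ.- seq y n
(x -ℝ y) .cauchy = +-cauchy (seq x) (λ n → ℚ.- seq y n) (cauchy x) (-‿cauchy (seq y) (cauchy y))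

-- s = √r
IsSqrt : (r s : ℝ) → Set
IsSqrt r s = 0ℝ ≤ℝ s × s *ℝ s ≈ r

+ℝ-rawMonoid : RawMonoid 0ℓ 0ℓ
+ℝ-rawMonoid = record { Carrier = ℝ ; _≈_ = _≈_ ; _∙_ = _+ℝ_ ; ε = 0ℝ }

open import Algebra.Definitions.RawMonoid +ℝ-rawMonoid public using (sum)

------------------------------------------------------------------------
-- Matrices and eigenvalues

Matrix : ℕ → Set
Matrix n = Fin n → Fin n → ℝ

IsEigenvalue : ∀ {n} → Matrix n → ℝ → Set
IsEigenvalue {n} M μ = Σ[ x ∈ Vector ℝ n ]
  ¬ (∀ i → x i ≈ 0ℝ) × (∀ i → sum (λ j → M i j *ℝ x j) ≈ μ *ℝ x i)

IsLargestEigenvalue : ∀ {n} → Matrix n → ℝ → Set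
IsLargestEigenvalue M μ = IsEigenvalue M μ × (∀ ν → IsEigenvalue M ν → ν ≤ℝ μ)

------------------------------------------------------------------------
-- Finite simple graphs of order n

record Graph (n : ℕ) : Set₁ where
  field
    Adj    : Rel (Fin n) 0ℓ
    adj?   : Decidable Adj
    symm   : Symmetric Adj
    irrefl : Irreflexive _≡_ Adj

module _ {n : ℕ} (G : Graph n) where
  open Graph G

  degree : Fin n → ℕ
  degree i = length (filter (adj? i) (allFin n))

  HasMinDegree : ℕ → Set
  HasMinDegree δ = (∀ i → δ ℕ.≤ degree i) × ∃[ i ] degree i ≡ δ

  Connected : Set
  Connected = ∀ i j → Star Adj i j

  adjacencyMatrix : Matrix n
  adjacencyMatrix i j = if ⌊ adj? i j ⌋ then 1ℝ else 0ℝ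

  degreeMatrix : Matrix n
  degreeMatrix i j = if ⌊ i Fin.≟ j ⌋ then fromℕ (degree i) else 0ℝ

  alphaMatrix : ℝ → Matrix n
  alphaMatrix α i j = α *ℝ degreeMatrix i j +ℝ (1ℝ -ℝ α) *ℝ adjacencyMatrix i j

  record Path (u v : Fin n) : Set where
    field
      vertices : List (Fin n)
      linked   : Linked Adj vertices
      unique   : Unique vertices
      start    : head vertices ≡ just u
      end      : last vertices ≡ just v

  ManyToManyDisjointPathCoverable : ℕ → Set
  ManyToManyDisjointPathCoverable t =
    (u v : Fin t → Fin n) → Injective _≡_ _≡_ u → Injective _≡_ _≡_ v →
    (∀ i j → u i ≢ v j) →
    Σ[ τ ∈ Permutation′ t ]
    Σ[ P ∈ (∀ i → Path (u i) (v (τ ⟨$⟩ʳ i))) ]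
    (∀ w → ∃! _≡_ (λ i → w ∈ Path.vertices (P i)))

------------------------------------------------------------------------
-- The numerical parameters.  Every truncated subtraction below is exact
-- when 4 ≤ 2t ≤ δ ≤ h n t.

h : (n t : ℕ) → ℕ
h n t = (n ℕ.+ t ℕ.∸ 1) ℕ./ 2

f₀ g₀ h₀ : (n t δ : ℕ) → ℕ
f₀ n t δ = (n ℕ.+ t ℕ.∸ δ) C 2 ℕ.+ (δ ℕ.∸ t) ℕ.* δ
g₀ n t δ = (n ℕ.+ t ℕ.∸ h n t) C 2 ℕ.+ (h n t ℕ.∸ t ℕ.∸ 1) ℕ.* h n t ℕ.+ δ
h₀ n t δ = f₀ n t δ ℕ.⊔ g₀ n t δ

-- The bound on the spectral radius is ½ (linearTerm + √ discriminant).
linearTerm : (n δ : ℕ) → ℝ → ℝ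
linearTerm n δ α = fromℕ δ +ℝ α *ℝ fromℕ n -ℝ α *ℝ fromℕ δ -ℝ 1ℝ

discriminant : (n t δ : ℕ) → ℝ → ℝ
discriminant n t δ α =
  linearTerm n δ α *ℝ linearTerm n δ α +ℝ
  fromℕ 4 *ℝ (1ℝ -ℝ α) *ℝ
    (fromℕ 2 *ℝ fromℕ (h₀ n t δ) -ℝ fromℕ n *ℝ fromℕ δ +ℝ fromℕ δ)

{-# OPTIONS --safe #-}

-- Spectral part: let M = A_α(G), and let b and c be such that λ² − bλ − c has
-- the stated bound as its larger root when 2e(G) is replaced by 2h₀.  If
-- 2e(G) ≤ 2h₀, the column sums of M² − bM are at most c, because a vertex of
-- degree d leaves n − 1 − d non-neighbours of degree at least δ.  Testing
-- M|x| ≥ λ|x| against the all-one vector and the degree vector then gives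
-- (λ² − bλ − c) Σ|xᵢ| ≤ 0, so x vanishes.  Hence e(G) > h₀.
--
-- Combinatorial part: if x and y are non-adjacent with d(x) + d(y) ≥ n + t, a
-- path system using the edge xy can be rerouted without it (Bondy–Chvátal).
-- So, adding edges, either the complete graph is reached, or a non-adjacent
-- pair with maximal degree sum, below n + t, shows that for some i between δ
-- and h at least i − t vertices have degree at most i.  Choosing a vertex of
-- degree δ among these bounds e(G) by a convex function of i, whose values
-- at δ and h are f₀ and g₀; this contradicts e(G) > h₀.

module Submission where

open import Defs
open import Algebra.Bundles using (CommutativeRing)
import Algebra.Properties.Semiring.Sum as SemiringSum
import Algebra.Solver.CommutativeMonoid as CommutativeMonoidSolver
open import Data.Bool.Base using (if_then_else_)
open import Data.Fin.Base using (Fin; zero; suc)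
open import Data.Fin.Permutation using (permutation)
import Data.Fin.Properties as Fin
import Data.Integer.Base as ℤ
import Data.Integer.Properties as ℤ
open import Data.List.Base
  using (List; []; _∷_; [_]; _++_; length; filter; map; take; tabulate; head; last; allFin)
import Data.List.Properties as List
open import Data.List.Membership.Propositional using (_∈_; _∉_)
open import Data.List.Membership.Propositional.Properties
  using (∈-++⁺ˡ; ∈-++⁺ʳ; ∈-++⁻; ∈-∃++; ∈-tabulate⁺; ∈-tabulate⁻; ∈-allFin; ∈-filter⁺)
open import Data.List.Relation.Binary.Permutation.Propositional
  using (_↭_; refl; prep; swap; trans; ↭-sym; ↭-trans; ↭⇒↭ₛ; module PermutationReasoning)
import Data.List.Relation.Binary.Permutation.Propositional.Properties as ↭
import Data.List.Relation.Binary.Permutation.Setoid.Properties as ↭ₛ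
open import Data.List.Relation.Unary.All as All using (All; []; _∷_)
import Data.List.Relation.Unary.All.Properties as All
open import Data.List.Relation.Unary.AllPairs using ([]; _∷_)
open import Data.List.Relation.Unary.Any as Any using (here; there)
open import Data.List.Relation.Unary.Linked using (Linked; [-]; _∷_)
open import Data.List.Relation.Unary.Unique.Propositional using (Unique)
import Data.List.Relation.Unary.Unique.Propositional.Properties as Unique
open import Data.Maybe.Base using (just)
open import Data.Nat.Combinatorics using (_C_; nC1≡n; nCk+nC[k+1]≡[n+1]C[k+1])
import Data.Nat.Base as ℕ
import Data.Nat.DivMod as ℕ
open import Data.Nat.ListAction using () renaming (sum to sumℕ)
open import Data.Nat.ListAction.Properties using (sum-++; sum-↭)
import Data.Nat.Properties as ℕ
import Data.Nat.Tactic.RingSolver as ℕSolver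
open import Data.Product.Base using (Σ-syntax; ∃-syntax; _×_; _,_; proj₁; proj₂)
import Data.Rational.Properties as ℚ
import Data.Rational.Unnormalised.Base as ℚᵘ
import Data.Rational.Unnormalised.Properties as ℚᵘ
open import Data.Sum.Base using (_⊎_; inj₁; inj₂)
open import Function.Base using (_∘_; id)
open import Function.Definitions using (Injective)
open import Level using (0ℓ)
open import Relation.Binary.Core using (Rel)
open import Relation.Binary.Definitions as Binary using (Symmetric)
open import Relation.Binary.PropositionalEquality
  using (_≡_; _≢_; refl; sym; cong; cong₂; subst; module ≡-Reasoning)
import Relation.Binary.PropositionalEquality as ≡
open import Relation.Nullary using (¬_; yes; no; ¬?; _×-dec_; _⊎-dec_)
open import Relation.Nullary.Decidable using (⌊_⌋; dec⇒maybe; decidable-stable; map′)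
open import Relation.Nullary.Negation using (contradiction)
open import Relation.Unary using (Pred; Decidable)
open import Tactic.RingSolver.Core.AlmostCommutativeRing
  using (AlmostCommutativeRing; fromCommutativeRing)

-- Rerouting through a path other than the one that held xy exchanges the targets of two paths. This
-- is why a path system is kept as lists of sources, targets and vertices up to permutation, and τ
-- is read off only at the end. The threshold n + t comes from counting when no rerouting exists: on
-- an unbroken path the neighbours of x and those of y together exceed the number of vertices by at
-- most 1, on the two halves of the broken path not at all. That gives n + t - 1 in total.
--
-- In the spectral part, reals are Cauchy sequences and their order is undecidable. Every estimate
-- is therefore made on rational terms at one index, where the eigenvalue equation holds only up to
-- a residual. The strict hypothesis supplies a uniform gap e, which keeps λ² - bλ - c above e²/4
-- while the residuals tend to 0. The constants are b = α(n - 1) + (1 - α)(δ - 1), an average of a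
-- bound for the diagonal and one for the neighbours, and c = (1 - α)(2h₀ - (n - 1)δ).

module Combinatorics where

  open import Data.Nat.Base using (ℕ; zero; suc; _+_; _*_; _∸_; _≤_; _<_; z≤n; s≤s; >-nonZero)
  open import Data.Nat.Tactic.RingSolver using (solve-∀)

  -- Counting the entries of a list that satisfy a predicate

  module _ {A : Set} where

    # : {P : Pred A 0ℓ} → Decidable P → List A → ℕ
    # P? xs = length (filter P? xs)

    module _ {P : Pred A 0ℓ} (P? : Decidable P) where

      #-++ : ∀ xs ys → # P? (xs ++ ys) ≡ # P? xs + # P? ys
      #-++ xs ys = ≡.trans (cong length (List.filter-++ P? xs ys)) (List.length-++ (filter P? xs))

      #-∷ : ∀ x xs → # P? (x ∷ xs) ≡ # P? [ x ] + # P? xs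
      #-∷ x xs = #-++ [ x ] xs

      #-↭ : ∀ {xs ys} → xs ↭ ys → # P? xs ≡ # P? ys
      #-↭ xs↭ys = ↭.↭-length (↭.filter-↭ P? xs↭ys)

      #≤length : ∀ xs → # P? xs ≤ length xs
      #≤length = List.length-filter P?

      #-reject : ∀ {x} → ¬ P x → # P? [ x ] ≡ 0
      #-reject ¬Px = cong length (List.filter-reject P? ¬Px)

  -- Walks and path systems

  module _ {A : Set} where

    data Walk (R : Rel A 0ℓ) : A → A → List A → Set where
      point : ∀ a → Walk R a a (a ∷ [])
      _∷_ : ∀ {a b c l} → R a b → Walk R b c l → Walk R a c (a ∷ l)

    -- The vertices of all paths are concatenated in `ws`, so that disjointness and covering
    -- together become the single condition that `ws` is a permutation of `allFin n`.
    data Paths (R : Rel A 0ℓ) : (us vs ws : List A) → Set where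
      []  : Paths R [] [] []
      _∷_ : ∀ {a b l us vs ws} → Walk R a b l → Paths R us vs ws →
            Paths R (a ∷ us) (b ∷ vs) (l ++ ws)

    -- Sources and targets are permuted independently, so no source is tied to a particular target.
    -- This is the freedom that τ has.
    Coverable : Rel A 0ℓ → (us vs ws : List A) → Set
    Coverable R us vs ws = ∃[ us′ ] ∃[ vs′ ] ∃[ ws′ ]
      Paths R us′ vs′ ws′ × us′ ↭ us × vs′ ↭ vs × ws′ ↭ ws

    source∈ : ∀ {R a b l} → Walk R a b l → a ∈ l
    source∈ (point a) = here refl
    source∈ (_ ∷ _) = here refl

    target∈ : ∀ {R a b l} → Walk R a b l → b ∈ l
    target∈ (point a) = here refl
    target∈ (_ ∷ w) = there (target∈ w)

    join : ∀ {R a b c d l m} → Walk R a b l → R b c → Walk R c d m → Walk R a d (l ++ m)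
    join (point a) r w = r ∷ w
    join (q ∷ v)   r w = q ∷ join v r w

    reverseWalk : ∀ {R a b l} → Symmetric R → Walk R a b l → ∃[ m ] Walk R b a m × m ↭ l
    reverseWalk R-sym (point a) = [ a ] , point a , refl
    reverseWalk R-sym (_∷_ {a = a} r w) with reverseWalk R-sym w
    ... | m , w′ , m↭l = m ++ [ a ] , join w′ (R-sym r) (point a) ,
      ↭-trans (↭-sym (↭.∷↭∷ʳ a m)) (prep a m↭l)

    -- Meant for `R` equal to `S` with an extra edge at `z`: a walk that misses `z` cannot use this
    -- edge.
    mapWalk : ∀ {R S : Rel A 0ℓ} {z a b l} → (∀ {c d} → R c d → c ≢ z → d ≢ z → S c d) →
              z ∉ l → Walk R a b l → Walk S a b l
    mapWalk f z∉l (point a) = point a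
    mapWalk f z∉l (r ∷ w) =
      f r (λ { refl → z∉l (here refl) }) (λ { refl → z∉l (there (source∈ w)) })
      ∷ mapWalk f (z∉l ∘ there) w

    mapPaths : ∀ {R S : Rel A 0ℓ} {z us vs ws} → (∀ {c d} → R c d → c ≢ z → d ≢ z → S c d) →
               z ∉ ws → Paths R us vs ws → Paths S us vs ws
    mapPaths f z∉ws []                = []
    mapPaths f z∉ws (_∷_ {l = l} w p) =
      mapWalk f (z∉ws ∘ ∈-++⁺ˡ) w ∷ mapPaths f (z∉ws ∘ ∈-++⁺ʳ l) p

    -- `P` and `Q` will be the neighbourhoods of the two vertices to be merged, so that the loose
    -- ends `c` and `d` can each be attached to one of them. The edge between `c` and `d` is not
    -- recorded, since rerouting discards it.
    record Cut (R : Rel A 0ℓ) (P Q : Pred A 0ℓ) (a b : A) (l : List A) : Set where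
      constructor cut
      field
        {c d}   : A
        {l₁ l₂} : List A
        front   : Walk R a c l₁
        back    : Walk R d b l₂
        Pc      : P c
        Qd      : Q d
        split   : l ≡ l₁ ++ l₂

    record CutPaths (R : Rel A 0ℓ) (P Q : Pred A 0ℓ) (us vs ws : List A) : Set where
      constructor cutPaths
      field
        {a b}         : A
        {l}           : List A
        {us′ vs′ ws′} : List A
        theCut        : Cut R P Q a b l
        others        : Paths R us′ vs′ ws′
        us↭           : a ∷ us′ ↭ us
        vs↭           : b ∷ vs′ ↭ vs
        ws↭           : l ++ ws′ ↭ ws

    there-cut : ∀ {R P Q a b l us vs ws} → Walk R a b l → CutPaths R P Q us vs ws →
                CutPaths R P Q (a ∷ us) (b ∷ vs) (l ++ ws)
    there-cut {a = a} {b} {l} w (cutPaths {a′} {b′} {l′} {ws′ = ws′} k p us↭ vs↭ ws↭) = cutPaths k (w ∷ p)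
      (trans (swap a′ a refl) (prep a us↭)) (trans (swap b′ b refl) (prep b vs↭))
      (trans (↭.shifts l′ l) (↭.++⁺ˡ l ws↭))

    module _ {R : Rel A 0ℓ} {P Q : Pred A 0ℓ} (P? : Decidable P) (Q? : Decidable Q) where

      private
        step : ∀ pa p qc qa q l β → pa + qc ≤ 1 → suc (p + q) ≤ l + (β + qc) →
               suc ((pa + p) + (qa + q)) ≤ suc l + (β + qa)
        step pa p qc qa q l β pa+qc≤1 IH = begin
          suc ((pa + p) + (qa + q))     ≡⟨ lhs pa p qa q ⟩
          (pa + qa) + suc (p + q)       ≤⟨ ℕ.+-monoʳ-≤ (pa + qa) IH ⟩
          (pa + qa) + (l + (β + qc))    ≡⟨ rhs pa qa l β qc ⟩
          (pa + qc) + (l + (β + qa))    ≤⟨ ℕ.+-monoˡ-≤ (l + (β + qa)) pa+qc≤1 ⟩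
          suc l + (β + qa)              ∎
          where
          open ℕ.≤-Reasoning
          lhs : ∀ pa p qa q → suc ((pa + p) + (qa + q)) ≡ (pa + qa) + suc (p + q)
          lhs = solve-∀
          rhs : ∀ pa qa l β qc → (pa + qa) + (l + (β + qc)) ≡ (pa + qc) + (l + (β + qa))
          rhs = solve-∀

        step-∷ : ∀ a c l b → # P? [ a ] + # Q? [ c ] ≤ 1 →
                 suc (# P? l + # Q? l) ≤ length l + (# P? [ b ] + # Q? [ c ]) →
                 suc (# P? (a ∷ l) + # Q? (a ∷ l)) ≤ suc (length l) + (# P? [ b ] + # Q? [ a ])
        step-∷ a c l b Pa+Qc≤1 IH rewrite #-∷ P? a l | #-∷ Q? a l =
          step (# P? [ a ]) (# P? l) (# Q? [ c ]) (# Q? [ a ]) (# Q? l) (length l) (# P? [ b ]) Pa+Qc≤1 IH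

        both⊎≤1 : ∀ a c → (P a × Q c) ⊎ # P? [ a ] + # Q? [ c ] ≤ 1
        both⊎≤1 a c with P? a | Q? c
        ... | yes Pa | yes Qc = inj₁ (Pa , Qc)
        ... | yes _  | no _   = inj₂ ℕ.≤-refl
        ... | no _   | yes _  = inj₂ ℕ.≤-refl
        ... | no _   | no _   = inj₂ z≤n

      -- Without a cut, the Q-vertices shifted one step back miss the P-vertices.
      cutWalk : ∀ {a b l} → Walk R a b l → Cut R P Q a b l ⊎
        suc (# P? l + # Q? l) ≤ length l + (# P? [ b ] + # Q? [ a ])
      cutWalk (point a) = inj₂ ℕ.≤-refl
      cutWalk {a} {b} (_∷_ {b = c} {l = l} r w) with both⊎≤1 a c | cutWalk w
      ... | _              | inj₁ (cut v v′ Pc Qd refl) = inj₁ (cut (r ∷ v) v′ Pc Qd refl)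
      ... | inj₁ (Pa , Qc) | inj₂ _                     = inj₁ (cut (point a) w Pa Qc refl)
      ... | inj₂ Pa+Qc≤1   | inj₂ IH                    = inj₂ (step-∷ a c l b Pa+Qc≤1 IH)

      -- The two end terms of `cutWalk` are at most 1 each, so the count on a path exceeds its
      -- number of vertices by at most 1. Over the system, the excess is at most the number of
      -- paths.
      cutPath : ∀ {us vs ws} → Paths R us vs ws → CutPaths R P Q us vs ws ⊎
        # P? ws + # Q? ws ≤ length ws + length us
      cutPath [] = inj₂ z≤n
      cutPath (_∷_ {a} {b} {l} {us} {vs} {ws} w p) with cutWalk w | cutPath p
      ... | inj₁ k | _      = inj₁ (cutPaths k p refl refl refl)
      ... | inj₂ _ | inj₁ k = inj₁ (there-cut w k)
      ... | inj₂ m | inj₂ n rewrite #-++ P? l ws | #-++ Q? l ws | List.length-++ l {ws} = inj₂ (begin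
        (# P? l + # P? ws) + (# Q? l + # Q? ws)
          ≡⟨ interchange (# P? l) (# P? ws) (# Q? l) (# Q? ws) ⟩
        (# P? l + # Q? l) + (# P? ws + # Q? ws)
          ≤⟨ ℕ.+-mono-≤ (loosen (length l) (#≤length P? [ b ]) (#≤length Q? [ a ]) m) n ⟩
        suc (length l) + (length ws + length us)
          ≡⟨ rearrange (length l) (length ws) (length us) ⟩
        (length l + length ws) + suc (length us) ∎)
        where
        open ℕ.≤-Reasoning
        loosen : ∀ l {k β κ} → β ≤ 1 → κ ≤ 1 → suc k ≤ l + (β + κ) → k ≤ suc l
        loosen l β≤1 κ≤1 k<l+2 = ℕ.≤-pred (ℕ.≤-trans k<l+2
          (ℕ.≤-trans (ℕ.+-monoʳ-≤ l (ℕ.+-mono-≤ β≤1 κ≤1)) (ℕ.≤-reflexive (ℕ.+-comm l 2))))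
        interchange : ∀ p p′ q q′ → (p + p′) + (q + q′) ≡ (p + q) + (p′ + q′)
        interchange = solve-∀
        rearrange : ∀ l ws us → suc l + (ws + us) ≡ (l + ws) + suc us
        rearrange = solve-∀

    open CommutativeMonoidSolver (↭.++-commutativeMonoid {A = A}) using (solve; _⊕_; _⊜_)

    module _ {R : Rel A 0ℓ} (R-sym : Symmetric R) (R? : Binary.Decidable R) {x y : A}
             (x≁x : ¬ R x x) (y≁y : ¬ R y y) where

      -- The rerouting step of the Bondy–Chvátal closure: x ends one half path,
      -- y begins another, and the two halves need to be merged.
      reroute : ∀ {u v A B us vs ws} → Walk R u x A → Walk R y v B → Paths R us vs ws →
                length (A ++ B ++ ws) + length us <
                  # (R? x) (A ++ B ++ ws) + # (R? y) (A ++ B ++ ws) →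
                Coverable R (u ∷ us) (v ∷ vs) (A ++ B ++ ws)
      reroute {u} {v} {A} {B} {us} {vs} {ws} α β p dense
        with cutWalk (R? x) (R? y) α | cutWalk (R? x) (R? y) β | cutPath (R? y) (R? x) p
      ... | inj₁ (cut {l₁ = l₁} {l₂} front back x~c y~d refl) | _ | _ with reverseWalk R-sym back
      -- New path: from u to c, across to x, backwards to d, across to y, on to v.
      ...   | m , back′ , m↭l₂ =
        _ , _ , _ , join front (R-sym x~c) (join back′ (R-sym y~d) β) ∷ p , refl , refl ,
        (begin
          (l₁ ++ m ++ B) ++ ws   ↭⟨ ↭.++-assoc l₁ (m ++ B) ws ⟩
          l₁ ++ (m ++ B) ++ ws   ↭⟨ ↭.++⁺ˡ l₁ (↭.++⁺ʳ ws (↭.++⁺ʳ B m↭l₂)) ⟩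
          l₁ ++ (l₂ ++ B) ++ ws  ↭⟨ solve 4 (λ l₁ l₂ B ws → l₁ ⊕ ((l₂ ⊕ B) ⊕ ws) ⊜ (l₁ ⊕ l₂) ⊕ (B ⊕ ws)) refl l₁ l₂ B ws ⟩
          (l₁ ++ l₂) ++ B ++ ws  ∎)
        where open PermutationReasoning
      reroute {u} {v} {A} {B} {us} {vs} {ws} α β p dense
          | inj₂ _ | inj₁ (cut {l₁ = l₁} {l₂} front back x~c y~d refl) | _ with reverseWalk R-sym front
      -- New path: from u to x, across to c, backwards to y, across to d, on to v.
      ...   | m , front′ , m↭l₁ =
        _ , _ , _ , join α x~c (join front′ y~d back) ∷ p , refl , refl ,
        (begin
          (A ++ m ++ l₂) ++ ws   ↭⟨ ↭.++⁺ʳ ws (↭.++⁺ˡ A (↭.++⁺ʳ l₂ m↭l₁)) ⟩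
          (A ++ l₁ ++ l₂) ++ ws  ↭⟨ ↭.++-assoc A (l₁ ++ l₂) ws ⟩
          A ++ (l₁ ++ l₂) ++ ws  ∎)
        where open PermutationReasoning
      -- Here u is led to the target of the other path and the source of that path to v, so the
      -- targets are exchanged. The neighbourhoods enter `cutPath` in the opposite order because x
      -- ends a half path and continues into d, while y begins one and is entered from c.
      reroute {u} {v} {A} {B} {us} {vs} {ws} α β p dense
          | inj₂ _ | inj₂ _ | inj₁ (cutPaths {a} {b} {us′ = us′} {vs′} {ws′}
              (cut {l₁ = l₁} {l₂} front back y~c x~d refl) q us↭ vs↭ ws↭) =
        _ , _ , _ , join α x~d back ∷ join front (R-sym y~c) β ∷ q ,
        prep u us↭ ,
        trans (swap b v refl) (prep v vs↭) ,
        (begin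
          (A ++ l₂) ++ (l₁ ++ B) ++ ws′
            ↭⟨ solve 5 (λ A l₂ l₁ B ws′ → (A ⊕ l₂) ⊕ ((l₁ ⊕ B) ⊕ ws′) ⊜ A ⊕ (B ⊕ ((l₁ ⊕ l₂) ⊕ ws′)))
                 refl A l₂ l₁ B ws′ ⟩
          A ++ B ++ (l₁ ++ l₂) ++ ws′    ↭⟨ ↭.++⁺ˡ A (↭.++⁺ˡ B ws↭) ⟩
          A ++ B ++ ws                   ∎)
        where open PermutationReasoning
      reroute {u} {v} {A} {B} {us} {vs} {ws} α β p dense | inj₂ a | inj₂ b | inj₂ c =
        contradiction dense (ℕ.≤⇒≯ sparse)
        where
        open ℕ.≤-Reasoning
        tighten : ∀ l {k} q r → q + r ≤ 1 → suc k ≤ l + (q + r) → k ≤ l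
        tighten l _ _ q+r≤1 k<l+1 = ℕ.≤-pred (ℕ.≤-trans k<l+1
          (ℕ.≤-trans (ℕ.+-monoʳ-≤ l q+r≤1) (ℕ.≤-reflexive (ℕ.+-comm l 1))))
        -- The walk ends in x, which is no neighbour of itself. One end term of `cutWalk` vanishes
        -- and no excess is left; for `#B` the same holds at y.
        #A : # (R? x) A + # (R? y) A ≤ length A
        #A = tighten (length A) (# (R? x) [ x ]) (# (R? y) [ u ])
          (ℕ.+-mono-≤ (ℕ.≤-reflexive (#-reject (R? x) x≁x)) (#≤length (R? y) [ u ])) a
        #B : # (R? x) B + # (R? y) B ≤ length B
        #B = tighten (length B) (# (R? x) [ v ]) (# (R? y) [ y ])
          (ℕ.+-mono-≤ (#≤length (R? x) [ v ]) (ℕ.≤-reflexive (#-reject (R? y) y≁y))) b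
        #-++-++ : ∀ z → # (R? z) (A ++ B ++ ws) ≡ # (R? z) A + (# (R? z) B + # (R? z) ws)
        #-++-++ z = ≡.trans (#-++ (R? z) A (B ++ ws)) (cong (# (R? z) A +_) (#-++ (R? z) B ws))
        regroup : ∀ a a′ b b′ c c′ → (a + (b + c)) + (a′ + (b′ + c′)) ≡ (a + a′) + ((b + b′) + (c′ + c))
        regroup = solve-∀
        regroup′ : ∀ a b c d → a + (b + (c + d)) ≡ (a + (b + c)) + d
        regroup′ = solve-∀
        sparse : # (R? x) (A ++ B ++ ws) + # (R? y) (A ++ B ++ ws) ≤ length (A ++ B ++ ws) + length us
        sparse = begin
          # (R? x) (A ++ B ++ ws) + # (R? y) (A ++ B ++ ws)
            ≡⟨ cong₂ _+_ (#-++-++ x) (#-++-++ y) ⟩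
          (# (R? x) A + (# (R? x) B + # (R? x) ws)) + (# (R? y) A + (# (R? y) B + # (R? y) ws))
            ≡⟨ regroup (# (R? x) A) (# (R? y) A) (# (R? x) B) (# (R? y) B) (# (R? x) ws) (# (R? y) ws) ⟩
          (# (R? x) A + # (R? y) A) + ((# (R? x) B + # (R? y) B) + (# (R? y) ws + # (R? x) ws))
            ≤⟨ ℕ.+-mono-≤ #A (ℕ.+-mono-≤ #B c) ⟩
          length A + (length B + (length ws + length us))
            ≡⟨ regroup′ (length A) (length B) (length ws) (length us) ⟩
          (length A + (length B + length ws)) + length us
            ≡⟨ cong (_+ length us) (≡.trans (List.length-++ A) (cong (length A +_) (List.length-++ B))) ⟨
          length (A ++ B ++ ws) + length us ∎

    -- Adding and removing an edge

    data AddEdge (R : Rel A 0ℓ) (x y : A) : Rel A 0ℓ where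
      old : ∀ {a b} → R a b → AddEdge R x y a b
      new : AddEdge R x y x y
      wen : AddEdge R x y y x

    Unique-++⁻ˡ : ∀ (l : List A) {m} → Unique (l ++ m) → Unique l
    Unique-++⁻ˡ []      _         = []
    Unique-++⁻ˡ (x ∷ l) (x∉ ∷ u) = All.++⁻ˡ l x∉ ∷ Unique-++⁻ˡ l u

    Unique-++⁻ʳ : ∀ (l : List A) {m} → Unique (l ++ m) → Unique m
    Unique-++⁻ʳ []      u       = u
    Unique-++⁻ʳ (x ∷ l) (_ ∷ u) = Unique-++⁻ʳ l u

    Unique-++-disjoint : ∀ (l : List A) {m z} → Unique (l ++ m) → z ∈ l → z ∉ m
    Unique-++-disjoint (x ∷ l) (x∉ ∷ _) (here refl) z∈m = All.lookup x∉ (∈-++⁺ʳ l z∈m) refl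
    Unique-++-disjoint (x ∷ l) (_ ∷ u)  (there z∈l) z∈m = Unique-++-disjoint l u z∈l z∈m

    Unique-resp-↭ : ∀ {l m : List A} → l ↭ m → Unique l → Unique m
    Unique-resp-↭ l↭m = ↭ₛ.Unique-resp-↭ (≡.setoid A) (↭⇒↭ₛ l↭m)

    module _ {R : Rel A 0ℓ} {x y : A} where

      private
        R⁺ : Rel A 0ℓ
        R⁺ = AddEdge R x y

        Ends : Rel A 0ℓ
        Ends c d = c ≡ x × d ≡ y ⊎ c ≡ y × d ≡ x

        avoid : ∀ {c d} → Ends c d → ∀ {a b} → R⁺ a b → a ≢ c → b ≢ c → R a b
        avoid _                      (old r) _   _   = r
        avoid (inj₁ (refl , refl)) new     a≢c _   = contradiction refl a≢c
        avoid (inj₂ (refl , refl)) new     _   b≢c = contradiction refl b≢c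
        avoid (inj₁ (refl , refl)) wen     _   b≢c = contradiction refl b≢c
        avoid (inj₂ (refl , refl)) wen     a≢c _   = contradiction refl a≢c

      -- The cut is made at the first use of the new edge, so the front is free of it while the back
      -- may still contain it.
      removeFromWalk : ∀ {a b l} → Walk R⁺ a b l → Walk R a b l ⊎
        ∃[ c ] ∃[ d ] ∃[ l₁ ] ∃[ l₂ ] Ends c d × Walk R a c l₁ × Walk R⁺ d b l₂ × l ≡ l₁ ++ l₂
      removeFromWalk (point a) = inj₁ (point a)
      removeFromWalk (new ∷ w) = inj₂ (_ , _ , _ , _ , inj₁ (refl , refl) , point x , w , refl)
      removeFromWalk (wen ∷ w) = inj₂ (_ , _ , _ , _ , inj₂ (refl , refl) , point y , w , refl)
      removeFromWalk (old r ∷ w) with removeFromWalk w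
      ... | inj₁ w′ = inj₁ (r ∷ w′)
      ... | inj₂ (_ , _ , _ , _ , ends , w₁ , w₂ , refl) =
        inj₂ (_ , _ , _ , _ , ends , r ∷ w₁ , w₂ , refl)

      record Broken (us vs ws : List A) : Set where
        constructor broken
        field
          {c d u v}     : A
          {l₁ l₂}       : List A
          {us′ vs′ ws′} : List A
          ends          : Ends c d
          front         : Walk R u c l₁
          back          : Walk R d v l₂
          others        : Paths R us′ vs′ ws′
          us↭           : u ∷ us′ ↭ us
          vs↭           : v ∷ vs′ ↭ vs
          ws↭           : l₁ ++ l₂ ++ ws′ ↭ ws

      -- After the cut, `c` ends the front and, the vertices being distinct, occurs nowhere else.
      -- Hence neither the back nor any later path can use the new edge.
      removeFromPaths : ∀ {us vs ws} → Unique ws → Paths R⁺ us vs ws →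
                        Paths R us vs ws ⊎ Broken us vs ws
      removeFromPaths _ [] = inj₁ []
      removeFromPaths uniq (_∷_ {a} {b} {l} {ws = ws} w p) with removeFromWalk w
      ... | inj₂ (c , _ , l₁ , l₂ , ends , w₁ , w₂ , refl) = inj₂ (broken ends w₁
        (mapWalk (avoid ends) (Unique-++-disjoint l₁ (Unique-++⁻ˡ (l₁ ++ l₂) uniq) (target∈ w₁)) w₂)
        (mapPaths (avoid ends) (Unique-++-disjoint (l₁ ++ l₂) uniq (∈-++⁺ˡ (target∈ w₁))) p)
        refl refl (↭-sym (↭.++-assoc l₁ l₂ ws)))
      ... | inj₁ w′ with removeFromPaths (Unique-++⁻ʳ l uniq) p
      ...   | inj₁ p′ = inj₁ (w′ ∷ p′)
      ...   | inj₂ (broken {u = u} {v} {l₁} {l₂} {ws′ = ws′} ends w₁ w₂ p′ us↭ vs↭ ws↭) = inj₂ (broken ends w₁ w₂ (w′ ∷ p′)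
        (trans (swap u a refl) (prep a us↭)) (trans (swap v b refl) (prep b vs↭))
        (trans (solve 4 (λ l₁ l₂ l ws′ → l₁ ⊕ (l₂ ⊕ (l ⊕ ws′)) ⊜ l ⊕ (l₁ ⊕ (l₂ ⊕ ws′))) refl l₁ l₂ l ws′)
          (↭.++⁺ˡ l ws↭)))

    module _ {R : Rel A 0ℓ} (R-sym : Symmetric R) (R-irrefl : ∀ {z} → ¬ R z z)
             (R? : Binary.Decidable R) {us vs ws : List A} (uniq : Unique ws) where

      private
        repair : ∀ {x y us′ vs′ ws′} → length ws + length us ≤ # (R? x) ws + # (R? y) ws →
                 us′ ↭ us → vs′ ↭ vs → ws′ ↭ ws → ∀ {u v l₁ l₂ us″ vs″ ws″} →
                 Walk R u x l₁ → Walk R y v l₂ → Paths R us″ vs″ ws″ →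
                 u ∷ us″ ↭ us′ → v ∷ vs″ ↭ vs′ → l₁ ++ l₂ ++ ws″ ↭ ws′ →
                 Coverable R us vs ws
        repair {x} {y} dense us′↭ vs′↭ ws′↭ {u} {l₁ = l₁} {l₂} {us″} {ws″ = ws″} w₁ w₂ p us″↭ vs″↭ ws″↭
          = let _ , _ , _ , q , us‴↭ , vs‴↭ , ws‴↭ = reroute R-sym R? R-irrefl R-irrefl w₁ w₂ p dense′
            in _ , _ , _ , q , trans us‴↭ us↭ , trans vs‴↭ (trans vs″↭ vs′↭) , trans ws‴↭ ws↭
          where
          us↭ : u ∷ us″ ↭ us
          us↭ = trans us″↭ us′↭
          ws↭ : l₁ ++ l₂ ++ ws″ ↭ ws
          ws↭ = trans ws″↭ ws′↭
          open ℕ.≤-Reasoning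
          dense′ : length (l₁ ++ l₂ ++ ws″) + length us″ <
                   # (R? x) (l₁ ++ l₂ ++ ws″) + # (R? y) (l₁ ++ l₂ ++ ws″)
          dense′ = begin
            suc (length (l₁ ++ l₂ ++ ws″) + length us″)
              ≡⟨ ℕ.+-suc (length (l₁ ++ l₂ ++ ws″)) (length us″) ⟨
            length (l₁ ++ l₂ ++ ws″) + length (u ∷ us″)
              ≡⟨ cong₂ _+_ (↭.↭-length ws↭) (↭.↭-length us↭) ⟩
            length ws + length us
              ≤⟨ dense ⟩
            # (R? x) ws + # (R? y) ws
              ≡⟨ cong₂ _+_ (#-↭ (R? x) ws↭) (#-↭ (R? y) ws↭) ⟨
            # (R? x) (l₁ ++ l₂ ++ ws″) + # (R? y) (l₁ ++ l₂ ++ ws″) ∎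

      -- In the application `length ws + length us` is n + t. Here `us` counts the broken path too,
      -- whereas `reroute` counts only the others; the weak inequality thus becomes the strict one
      -- needed there.
      removeEdge : ∀ {x y} → length ws + length us ≤ # (R? x) ws + # (R? y) ws →
                   Coverable (AddEdge R x y) us vs ws → Coverable R us vs ws
      removeEdge {x} {y} dense (_ , _ , _ , p , us↭ , vs↭ , ws↭)
        with removeFromPaths (Unique-resp-↭ (↭-sym ws↭) uniq) p
      ... | inj₁ p′ = _ , _ , _ , p′ , us↭ , vs↭ , ws↭
      ... | inj₂ (broken (inj₁ (refl , refl)) w₁ w₂ q us′↭ vs′↭ ws′↭) =
        repair dense us↭ vs↭ ws↭ w₁ w₂ q us′↭ vs′↭ ws′↭
      ... | inj₂ (broken (inj₂ (refl , refl)) w₁ w₂ q us′↭ vs′↭ ws′↭) =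
        repair (subst (length ws + length us ≤_) (ℕ.+-comm (# (R? x) ws) _) dense) us↭ vs↭ ws↭ w₁ w₂ q us′↭ vs′↭ ws′↭

  -- Reordering path systems, and path systems in complete graphs

  module _ {A : Set} where

    open CommutativeMonoidSolver (↭.++-commutativeMonoid {A = A}) using (solve; _⊕_; _⊜_)

    unique-⊆⇒↭ : ∀ (xs : List A) {ys} → Unique xs → (∀ {z} → z ∈ xs → z ∈ ys) →
                 ∃[ zs ] ys ↭ xs ++ zs
    unique-⊆⇒↭ []       {ys} _        _     = ys , refl
    unique-⊆⇒↭ (x ∷ xs) (x∉ ∷ uniq) xs⊆ys with ∈-∃++ (xs⊆ys (here refl))
    ... | as , bs , refl with unique-⊆⇒↭ xs {as ++ bs} uniq xs⊆
      where
      xs⊆ : ∀ {z} → z ∈ xs → z ∈ as ++ bs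
      xs⊆ z∈ with ↭.∈-resp-↭ (↭.shift x as bs) (xs⊆ys (there z∈))
      ... | here refl = contradiction refl (All.lookup x∉ z∈)
      ... | there z∈′ = z∈′
    ...   | zs , ↭zs = zs , trans (↭.shift x as bs) (prep x ↭zs)

    -- The order of the sources is prescribed by `u`. The targets may end up in any order, which τ
    -- absorbs.
    sortSources : ∀ {R : Rel A 0ℓ} {us us′ vs ws} → us ↭ us′ → Paths R us vs ws →
                  ∃[ vs′ ] ∃[ ws′ ] Paths R us′ vs′ ws′ × vs′ ↭ vs × ws′ ↭ ws
    sortSources refl p = _ , _ , p , refl , refl
    sortSources (prep _ us↭) (_∷_ {b = b} {l} w p) with sortSources us↭ p
    ... | _ , _ , p′ , vs↭ , ws↭ = _ , _ , w ∷ p′ , prep b vs↭ , ↭.++⁺ˡ l ws↭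
    sortSources (swap _ _ us↭) (_∷_ {b = b} {l} w (_∷_ {b = b′} {l′} {ws = ws} w′ p)) with sortSources us↭ p
    ... | _ , _ , p′ , vs↭ , ws↭ = _ , _ , w′ ∷ w ∷ p′ , swap b′ b vs↭ ,
      trans (↭.++⁺ˡ l′ (↭.++⁺ˡ l ws↭)) (↭.shifts l′ l)
    sortSources (trans us↭ us↭′) p with sortSources us↭ p
    ... | _ , _ , p′ , vs↭ , ws↭ with sortSources us↭′ p′
    ...   | _ , _ , p″ , vs↭′ , ws↭′ = _ , _ , p″ , trans vs↭′ vs↭ , trans ws↭′ ws↭

    module _ {R : Rel A 0ℓ} (complete : ∀ {a b} → a ≢ b → R a b) where

      completeWalk : ∀ a l b → Unique (a ∷ l ++ [ b ]) → Walk R a b (a ∷ l ++ [ b ])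
      completeWalk a []      b ((a≢b ∷ []) ∷ _)  = complete a≢b ∷ point b
      completeWalk a (c ∷ l) b ((a≢c ∷ _) ∷ uniq) = complete a≢c ∷ completeWalk c l b uniq

      completePaths : ∀ us vs → length us ≡ length vs → (∀ {a b} → a ∈ us → b ∈ vs → a ≢ b) →
                      ∃[ ws ] Paths R us vs ws × us ++ vs ↭ ws
      completePaths []       []       _  _    = [] , [] , refl
      completePaths (u ∷ us) (v ∷ vs) eq disj
        with completePaths us vs (ℕ.suc-injective eq) (λ a∈ b∈ → disj (there a∈) (there b∈))
      ... | ws , p , ↭ws = u ∷ v ∷ ws , (complete (disj (here refl) (here refl)) ∷ point v) ∷ p ,
        prep u (trans (↭.shift v us vs) (prep v ↭ws))

      -- All pairs but the first are joined by single edges, and the path of the first pair collects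
      -- every vertex outside `us ++ vs`.
      completeCoverable : ∀ us vs ws → 0 < length us → length us ≡ length vs →
                          Unique (us ++ vs) → Unique ws → (∀ z → z ∈ ws) → Coverable R us vs ws
      completeCoverable (u ∷ us) (v ∷ vs) ws _ eq uniq uniq-ws full
        with unique-⊆⇒↭ ((u ∷ us) ++ (v ∷ vs)) uniq (λ {z} _ → full z)
           | completePaths us vs (ℕ.suc-injective eq) disj
        where
        disj : ∀ {a b} → a ∈ us → b ∈ vs → a ≢ b
        disj a∈ b∈ refl = Unique-++-disjoint (u ∷ us) uniq (there a∈) (there b∈)
      ... | zs , ws↭ | ws′ , p , ↭ws′ = _ , _ , _ , w ∷ p , refl , refl , ws″↭ws
        where
        ws″↭ws : (u ∷ zs ++ [ v ]) ++ ws′ ↭ ws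
        ws″↭ws = begin
          (u ∷ zs ++ [ v ]) ++ ws′       ↭⟨ ↭.++⁺ˡ (u ∷ zs ++ [ v ]) ↭ws′ ⟨
          (u ∷ zs ++ [ v ]) ++ us ++ vs
            ↭⟨ solve 5 (λ u zs v us vs → (u ⊕ (zs ⊕ v)) ⊕ (us ⊕ vs) ⊜ ((u ⊕ us) ⊕ (v ⊕ vs)) ⊕ zs)
                 refl [ u ] zs [ v ] us vs ⟩
          ((u ∷ us) ++ (v ∷ vs)) ++ zs   ↭⟨ ws↭ ⟨
          ws                             ∎
          where open PermutationReasoning
        w : Walk R u v (u ∷ zs ++ [ v ])
        w = completeWalk u zs v
          (Unique-++⁻ˡ (u ∷ zs ++ [ v ]) (Unique-resp-↭ (↭-sym ws″↭ws) uniq-ws))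

    -- From path systems to the paths of the definition

    record Indexed (R : Rel A 0ℓ) {t} (u : Fin t → A) (vs ws : List A) : Set where
      constructor indexed
      field
        end      : Fin t → A
        verts    : Fin t → List A
        walk     : ∀ i → Walk R (u i) (end i) (verts i)
        ends     : vs ≡ tabulate end
        unique   : ∀ i → Unique (verts i)
        within   : ∀ i {z} → z ∈ verts i → z ∈ ws
        covered  : ∀ {z} → z ∈ ws → ∃[ i ] z ∈ verts i
        disjoint : ∀ i j {z} → z ∈ verts i → z ∈ verts j → i ≡ j

    index : ∀ {R : Rel A 0ℓ} {t} (u : Fin t → A) {us vs ws} → us ≡ tabulate u → Unique ws →
            Paths R us vs ws → Indexed R u vs ws
    index {t = zero} u refl uniq [] =
      indexed (λ ()) (λ ()) (λ ()) refl (λ ()) (λ ()) (λ ()) (λ ())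
    index {R} {suc t} u {ws = lws} refl uniq (_∷_ {b = b} {l} {ws = ws} w p)
      with index (u ∘ suc) refl (Unique-++⁻ʳ l uniq) p
    ... | indexed end verts walk refl unique within covered disjoint =
      indexed end′ verts′ walk′ refl unique′ within′ covered′ disjoint′
      where
      end′ : Fin (suc t) → A
      end′ zero    = b
      end′ (suc i) = end i
      verts′ : Fin (suc t) → List A
      verts′ zero    = l
      verts′ (suc i) = verts i
      walk′ : ∀ i → Walk R (u i) (end′ i) (verts′ i)
      walk′ zero    = w
      walk′ (suc i) = walk i
      unique′ : ∀ i → Unique (verts′ i)
      unique′ zero    = Unique-++⁻ˡ l uniq
      unique′ (suc i) = unique i
      within′ : ∀ i {z} → z ∈ verts′ i → z ∈ l ++ ws
      within′ zero    = ∈-++⁺ˡ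
      within′ (suc i) = ∈-++⁺ʳ l ∘ within i
      covered′ : ∀ {z} → z ∈ l ++ ws → ∃[ i ] z ∈ verts′ i
      covered′ z∈ with ∈-++⁻ l z∈
      ... | inj₁ z∈l = zero , z∈l
      ... | inj₂ z∈ws = let i , z∈i = covered z∈ws in suc i , z∈i
      disjoint′ : ∀ i j {z} → z ∈ verts′ i → z ∈ verts′ j → i ≡ j
      disjoint′ zero    zero    _  _  = refl
      disjoint′ zero    (suc j) z∈ z∈′ = contradiction (within j z∈′) (Unique-++-disjoint l uniq z∈)
      disjoint′ (suc i) zero    z∈ z∈′ = contradiction (within i z∈) (Unique-++-disjoint l uniq z∈′)
      disjoint′ (suc i) (suc j) z∈ z∈′ = cong suc (disjoint i j z∈ z∈′)

    linked : ∀ {R : Rel A 0ℓ} {a b l} → Walk R a b l → Linked R l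
    linked (point a)             = [-]
    linked (r ∷ w@(point _))     = r ∷ linked w
    linked (r ∷ w@(_ ∷ _))       = r ∷ linked w

    head-walk : ∀ {R : Rel A 0ℓ} {a b l} → Walk R a b l → head l ≡ just a
    head-walk (point a) = refl
    head-walk (_ ∷ _)   = refl

    last-walk : ∀ {R : Rel A 0ℓ} {a b l} → Walk R a b l → last l ≡ just b
    last-walk (point a)         = refl
    last-walk (_ ∷ w@(point _)) = last-walk w
    last-walk (_ ∷ w@(_ ∷ _))   = last-walk w

  module _ {n} (G : Graph n) where
    open Graph G

    -- τ sends a source to the index in `v` of the end of its path. It is bijective because `v` is
    -- injective and disjoint paths have distinct ends.
    coverable⇒pathCoverable : ∀ {t} →
      (∀ (u v : Fin t → Fin n) → Unique (tabulate u ++ tabulate v) →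
        Coverable Adj (tabulate u) (tabulate v) (allFin n)) →
      ManyToManyDisjointPathCoverable G t
    coverable⇒pathCoverable {t} coverable u v u-inj v-inj u≢v
      with coverable u v (Unique.++⁺ (Unique.tabulate⁺ u-inj) (Unique.tabulate⁺ v-inj) disj)
      where
      disj : ∀ {z} → ¬ (z ∈ tabulate u × z ∈ tabulate v)
      disj (z∈u , z∈v) =
        let i , z≡ui = ∈-tabulate⁻ z∈u ; j , z≡vj = ∈-tabulate⁻ z∈v in u≢v i j (≡.trans (sym z≡ui) z≡vj)
    ... | us , vs , ws , p , us↭ , vs↭ , ws↭ with sortSources us↭ p
    ... | vs′ , ws′ , p′ , vs′↭ , ws′↭
      with index u refl (Unique-resp-↭ (↭-sym (trans ws′↭ ws↭)) (Unique.allFin⁺ n)) p′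
    ... | indexed end verts walk refl unique within covered disjoint =
      permutation τ σ (inverse v end τ σ v-inj σ-end τ-end) (inverse end v σ τ end-inj τ-end σ-end) ,
      (λ i → record
        { vertices = verts i
        ; linked   = linked (walk i)
        ; unique   = unique i
        ; start    = head-walk (walk i)
        ; end      = ≡.trans (last-walk (walk i)) (cong just (sym (τ-end i)))
        }) ,
      λ w → let i , w∈ = covered (↭.∈-resp-↭ (↭-sym (trans ws′↭ ws↭)) (∈-tabulate⁺ w)) in
        i , w∈ , disjoint i _ w∈
      where
      end↭v = trans vs′↭ vs↭
      toV : ∀ i → ∃[ j ] end i ≡ v j
      toV i = ∈-tabulate⁻ (↭.∈-resp-↭ end↭v (∈-tabulate⁺ i))
      fromV : ∀ j → ∃[ i ] v j ≡ end i
      fromV j = ∈-tabulate⁻ (↭.∈-resp-↭ (↭-sym end↭v) (∈-tabulate⁺ j))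
      τ σ : Fin t → Fin t
      τ = proj₁ ∘ toV
      σ = proj₁ ∘ fromV
      τ-end : ∀ i → v (τ i) ≡ end i
      τ-end = sym ∘ proj₂ ∘ toV
      σ-end : ∀ j → end (σ j) ≡ v j
      σ-end = sym ∘ proj₂ ∘ fromV
      end-inj : Injective _≡_ _≡_ end
      end-inj {i} {j} eq = disjoint i j (target∈ (walk i))
        (subst (_∈ verts j) (sym eq) (target∈ (walk j)))
      inverse : ∀ (f g : Fin t → Fin n) (τ σ : Fin t → Fin t) → Injective _≡_ _≡_ f →
                (∀ j → g (σ j) ≡ f j) → (∀ i → f (τ i) ≡ g i) → ∀ j → τ (σ j) ≡ j
      inverse f g τ σ f-inj gσ fτ j = f-inj (≡.trans (fτ (σ j)) (gσ j))

  -- Comparing counts, sums over lists, double counting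

  module _ {A : Set} where

    module _ {P Q : Pred A 0ℓ} (P? : Decidable P) (Q? : Decidable Q) (P⊆Q : ∀ {z} → P z → Q z) where

      #-mono : ∀ l → # P? l ≤ # Q? l
      #-mono []      = z≤n
      #-mono (x ∷ l) with P? x | Q? x
      ... | yes _  | yes _  = s≤s (#-mono l)
      ... | yes Px | no ¬Qx = contradiction (P⊆Q Px) ¬Qx
      ... | no _   | yes _  = ℕ.m≤n⇒m≤1+n (#-mono l)
      ... | no _   | no _   = #-mono l

      #-mono-< : ∀ {z l} → z ∈ l → ¬ P z → Q z → # P? l < # Q? l
      #-mono-< {l = x ∷ l} (here refl) ¬Pz Qz with P? x | Q? x
      ... | yes Px | _      = contradiction Px ¬Pz
      ... | no _   | yes _  = s≤s (#-mono l)
      ... | no _   | no ¬Qx = contradiction Qz ¬Qx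
      #-mono-< {l = x ∷ l} (there z∈) ¬Pz Qz with P? x | Q? x
      ... | yes _  | yes _  = s≤s (#-mono-< z∈ ¬Pz Qz)
      ... | yes Px | no ¬Qx = contradiction (P⊆Q Px) ¬Qx
      ... | no _   | yes _  = ℕ.m≤n⇒m≤1+n (#-mono-< z∈ ¬Pz Qz)
      ... | no _   | no _   = #-mono-< z∈ ¬Pz Qz

    #-cover : ∀ {P Q : Pred A 0ℓ} (P? : Decidable P) (Q? : Decidable Q) →
              (∀ z → P z ⊎ Q z) → ∀ l → length l ≤ # P? l + # Q? l
    #-cover P? Q? P⊎Q []      = z≤n
    #-cover P? Q? P⊎Q (x ∷ l) with P? x | Q? x | P⊎Q x | #-cover P? Q? P⊎Q l
    ... | yes _  | yes _  | _       | IH = s≤s (ℕ.≤-trans IH (ℕ.+-monoʳ-≤ (# P? l) (ℕ.n≤1+n (# Q? l))))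
    ... | yes _  | no _   | _       | IH = s≤s IH
    ... | no _   | yes _  | _       | IH = ℕ.≤-trans (s≤s IH) (ℕ.≤-reflexive (sym (ℕ.+-suc (# P? l) (# Q? l))))
    ... | no ¬Px | no _   | inj₁ Px | _  = contradiction Px ¬Px
    ... | no _   | no ¬Qx | inj₂ Qx | _  = contradiction Qx ¬Qx

    #-⊎ : ∀ {P Q : Pred A 0ℓ} (P? : Decidable P) (Q? : Decidable Q) l →
          # (λ z → P? z ⊎-dec Q? z) l ≤ # P? l + # Q? l
    #-⊎ P? Q? []      = z≤n
    #-⊎ P? Q? (x ∷ l) with P? x | Q? x | #-⊎ P? Q? l
    ... | yes _ | yes _ | IH = s≤s (ℕ.≤-trans IH (ℕ.+-monoʳ-≤ (# P? l) (ℕ.n≤1+n (# Q? l))))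
    ... | yes _ | no _  | IH = s≤s IH
    ... | no _  | yes _ | IH = ℕ.≤-trans (s≤s IH) (ℕ.≤-reflexive (sym (ℕ.+-suc (# P? l) (# Q? l))))
    ... | no _  | no _  | IH = IH

    #-none : ∀ {P : Pred A 0ℓ} (P? : Decidable P) {l} → All (¬_ ∘ P) l → # P? l ≡ 0
    #-none P? none = cong length (List.filter-none P? none)

    #-≡-unique : (_≟_ : Binary.DecidableEquality A) → ∀ y {l} → Unique l → # (_≟ y) l ≤ 1
    #-≡-unique _≟_ y []                    = z≤n
    #-≡-unique _≟_ y (_∷_ {x = x} x∉ uniq) with x ≟ y
    ... | yes refl = s≤s (ℕ.≤-reflexive (#-none (_≟ y) (All.map (λ x≢z → x≢z ∘ sym) x∉)))
    ... | no _     = #-≡-unique _≟_ y uniq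

    ∑ : (A → ℕ) → List A → ℕ
    ∑ f l = sumℕ (map f l)

    ∑-++ : ∀ f l m → ∑ f (l ++ m) ≡ ∑ f l + ∑ f m
    ∑-++ f l m = ≡.trans (cong sumℕ (List.map-++ f l m)) (sum-++ (map f l) (map f m))

    ∑-↭ : ∀ f {l m} → l ↭ m → ∑ f l ≡ ∑ f m
    ∑-↭ f l↭m = sum-↭ (↭.map⁺ f l↭m)

    ∑-mono : ∀ {f g : A → ℕ} → (∀ z → f z ≤ g z) → ∀ l → ∑ f l ≤ ∑ g l
    ∑-mono f≤g []      = z≤n
    ∑-mono f≤g (x ∷ l) = ℕ.+-mono-≤ (f≤g x) (∑-mono f≤g l)

    ∑-mono-< : ∀ {f g : A → ℕ} → (∀ z → f z ≤ g z) → ∀ {z l} → z ∈ l → f z < g z → ∑ f l < ∑ g l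
    ∑-mono-< f≤g {l = x ∷ l} (here refl) fz<gz = ℕ.+-mono-<-≤ fz<gz (∑-mono f≤g l)
    ∑-mono-< f≤g {l = x ∷ l} (there z∈)  fz<gz = ℕ.+-mono-≤-< (f≤g x) (∑-mono-< f≤g z∈ fz<gz)

    ∑-bound : ∀ {f : A → ℕ} {k} {l} → All (λ z → f z ≤ k) l → ∑ f l ≤ length l * k
    ∑-bound []         = z≤n
    ∑-bound (fx≤k ∷ p) = ℕ.+-mono-≤ fx≤k (∑-bound p)

    ∑-+ : ∀ (f g : A → ℕ) l → ∑ (λ z → f z + g z) l ≡ ∑ f l + ∑ g l
    ∑-+ f g []      = refl
    ∑-+ f g (x ∷ l) = ≡.trans (cong (f x + g x +_) (∑-+ f g l))
      (interchange (f x) (g x) (∑ f l) (∑ g l))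
      where
      interchange : ∀ a b c d → (a + b) + (c + d) ≡ (a + c) + (b + d)
      interchange = solve-∀

    ∑-cong : ∀ {f g : A → ℕ} → (∀ z → f z ≡ g z) → ∀ l → ∑ f l ≡ ∑ g l
    ∑-cong f≡g l = cong sumℕ (List.map-cong f≡g l)

    module _ {R : Rel A 0ℓ} (R-sym : Symmetric R) (R? : Binary.Decidable R) where

      private
        #-flip : ∀ a b → # (R? a) [ b ] ≡ # (R? b) [ a ]
        #-flip a b with R? a b | R? b a
        ... | yes _ | yes _ = refl
        ... | yes r | no ¬r = contradiction (R-sym r) ¬r
        ... | no ¬r | yes r = contradiction (R-sym r) ¬r
        ... | no _  | no _  = refl

        ∑-# : ∀ a m → ∑ (λ b → # (R? b) [ a ]) m ≡ # (R? a) m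
        ∑-# a []      = refl
        ∑-# a (b ∷ m) = ≡.trans (cong₂ _+_ (#-flip b a) (∑-# a m)) (sym (#-∷ (R? a) b m))

      -- Both sides count the related pairs between `l` and `m`; by symmetry of `R` each pair can be
      -- charged to either end.
      double-count : ∀ l m → ∑ (λ b → # (R? b) l) m ≡ ∑ (λ a → # (R? a) m) l
      double-count []      []      = refl
      double-count []      (b ∷ m) = double-count [] m
      double-count (a ∷ l) m = begin
        ∑ (λ b → # (R? b) (a ∷ l)) m                         ≡⟨ ∑-cong (λ b → #-∷ (R? b) a l) m ⟩
        ∑ (λ b → # (R? b) [ a ] + # (R? b) l) m              ≡⟨ ∑-+ (λ b → # (R? b) [ a ]) (λ b → # (R? b) l) m ⟩
        ∑ (λ b → # (R? b) [ a ]) m + ∑ (λ b → # (R? b) l) m  ≡⟨ cong₂ _+_ (∑-# a m) (double-count l m) ⟩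
        # (R? a) m + ∑ (λ c → # (R? c) m) l                  ∎
        where open ≡-Reasoning

      module _ (R-irrefl : ∀ {z} → ¬ R z z) where

        -- Pairs inside T number at most |T| (|T| − 1); all others have an end in S.
        degree-sum : ∀ {ws} S T → ws ↭ S ++ T →
          ∑ (λ v → # (R? v) ws) ws ≤ 2 * ∑ (λ v → # (R? v) ws) S + length T * (length T ∸ 1)
        degree-sum {ws} S T ws↭ = begin
          ∑ d ws
            ≡⟨ ≡.trans (∑-↭ d ws↭) (∑-++ d S T) ⟩
          ∑ d S + ∑ d T
            ≡⟨ cong (∑ d S +_) (≡.trans (∑-cong d-split T) (∑-+ (λ v → # (R? v) S) (λ v → # (R? v) T) T)) ⟩
          ∑ d S + (∑ (λ v → # (R? v) S) T + ∑ (λ v → # (R? v) T) T)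
            ≤⟨ ℕ.+-monoʳ-≤ (∑ d S) (ℕ.+-mono-≤ outer inner) ⟩
          ∑ d S + (∑ d S + length T * (length T ∸ 1))
            ≡⟨ double (∑ d S) (length T * (length T ∸ 1)) ⟩
          2 * ∑ d S + length T * (length T ∸ 1) ∎
          where
          open ℕ.≤-Reasoning
          d : A → ℕ
          d v = # (R? v) ws
          d-split : ∀ v → d v ≡ # (R? v) S + # (R? v) T
          d-split v = ≡.trans (#-↭ (R? v) ws↭) (#-++ (R? v) S T)
          outer : ∑ (λ v → # (R? v) S) T ≤ ∑ d S
          outer = begin
            ∑ (λ v → # (R? v) S) T  ≡⟨ double-count S T ⟩
            ∑ (λ v → # (R? v) T) S  ≤⟨ ∑-mono (λ v →
                ℕ.≤-trans (ℕ.m≤n+m (# (R? v) T) (# (R? v) S)) (ℕ.≤-reflexive (sym (d-split v)))) S ⟩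
            ∑ d S                   ∎
          inner : ∑ (λ v → # (R? v) T) T ≤ length T * (length T ∸ 1)
          inner = ∑-bound (All.tabulate λ {v} v∈T → ℕ.∸-monoˡ-≤ 1
            (List.filter-notAll (R? v) T (Any.map (λ { refl → R-irrefl }) v∈T)))
          double : ∀ s x → s + (s + x) ≡ 2 * s + x
          double = solve-∀

  -- Binomial coefficients and convexity of the edge bound

  2*nC2 : ∀ n → 2 * (n C 2) ≡ n * (n ∸ 1)
  2*nC2 zero    = refl
  2*nC2 (suc n) = begin
    2 * (suc n C 2)        ≡⟨ cong (2 *_) (nCk+nC[k+1]≡[n+1]C[k+1] n 1) ⟨
    2 * (n C 1 + n C 2)    ≡⟨ cong (λ k → 2 * (k + n C 2)) (nC1≡n n) ⟩
    2 * (n + n C 2)        ≡⟨ ℕ.*-distribˡ-+ 2 n (n C 2) ⟩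
    2 * n + 2 * (n C 2)    ≡⟨ cong (2 * n +_) (2*nC2 n) ⟩
    2 * n + n * (n ∸ 1)    ≡⟨ collect n ⟩
    suc n * n              ∎
    where
    open ≡-Reasoning
    collect : ∀ n → 2 * n + n * (n ∸ 1) ≡ suc n * n
    collect zero    = refl
    collect (suc n) = solved n
      where
      solved : ∀ n → 2 * suc n + suc n * n ≡ suc (suc n) * suc n
      solved = solve-∀

  -- q is the edge bound as a quadratic in the degree i = δ + x, where y = h − i;
  -- its leading coefficient 3 makes it convex.
  convex : ∀ m a b p r →
    let q = λ x y → (m + y) * suc (m + y) + 2 * ((a + x) * (b + x)) in
    q p r ≤ q 0 (r + p) ⊎ q p r ≤ q (p + r) 0
  convex m a b p zero rewrite ℕ.+-identityʳ p = inj₂ ℕ.≤-refl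
  convex m a b p r@(suc _) with q p r ℕ.≤? q 0 (r + p) | q p r ℕ.≤? q (p + r) 0
    where
    q : ℕ → ℕ → ℕ
    q x y = (m + y) * suc (m + y) + 2 * ((a + x) * (b + x))
  ... | yes ≤ₗ | _      = inj₁ ≤ₗ
  ... | no _   | yes ≤ᵣ = inj₂ ≤ᵣ
  ... | no ≰ₗ  | no ≰ᵣ  = contradiction convexity (ℕ.<⇒≱ strict)
    where
    q : ℕ → ℕ → ℕ
    q x y = (m + y) * suc (m + y) + 2 * ((a + x) * (b + x))
    identity : ∀ m a b p r →
      r * ((m + (r + p)) * suc (m + (r + p)) + 2 * ((a + 0) * (b + 0))) +
      p * ((m + 0) * suc (m + 0) + 2 * ((a + (p + r)) * (b + (p + r)))) ≡
      (r + p) * ((m + r) * suc (m + r) + 2 * ((a + p) * (b + p))) + 3 * (p * r * (p + r))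
    identity = solve-∀
    convexity : (r + p) * q p r ≤ r * q 0 (r + p) + p * q (p + r) 0
    convexity = ℕ.≤-trans (ℕ.m≤m+n _ (3 * (p * r * (p + r)))) (ℕ.≤-reflexive (sym (identity m a b p r)))
    strict : r * q 0 (r + p) + p * q (p + r) 0 < (r + p) * q p r
    strict = begin-strict
      r * q 0 (r + p) + p * q (p + r) 0
        <⟨ ℕ.+-mono-<-≤ (ℕ.*-monoʳ-< r (ℕ.≰⇒> ≰ₗ)) (ℕ.*-monoʳ-≤ p (ℕ.<⇒≤ (ℕ.≰⇒> ≰ᵣ))) ⟩
      r * q p r + p * q p r
        ≡⟨ ℕ.*-distribʳ-+ (q p r) r p ⟨
      (r + p) * q p r ∎
      where open ℕ.≤-Reasoning

  -- Degrees, added edges and the Bondy-Chvátal closure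

  module _ {n} (G : Graph n) where
    open Graph G

    ΣDegree : ℕ
    ΣDegree = ∑ (degree G) (allFin n)

    length-allFin : length (allFin n) ≡ n
    length-allFin = List.length-tabulate id

    degree≤n : ∀ i → degree G i ≤ n
    degree≤n i = ℕ.≤-trans (#≤length (adj? i) (allFin n)) (ℕ.≤-reflexive length-allFin)

    ΣDegree≤n*n : ΣDegree ≤ n * n
    ΣDegree≤n*n = ℕ.≤-trans (∑-bound (All.universal degree≤n (allFin n)))
      (ℕ.≤-reflexive (cong (_* n) length-allFin))

    addEdge : ∀ {x y} → x ≢ y → Graph n
    addEdge {x} {y} x≢y = record
      { Adj    = AddEdge Adj x y
      ; adj?   = dec
      ; symm   = λ { (old r) → old (symm r) ; new → wen ; wen → new }
      ; irrefl = λ { refl (old r) → irrefl refl r ; refl new → x≢y refl ; refl wen → x≢y refl }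
      }
      where
      dec : Binary.Decidable (AddEdge Adj x y)
      dec a b = map′
        (λ { (inj₁ r) → old r ; (inj₂ (inj₁ (refl , refl))) → new ; (inj₂ (inj₂ (refl , refl))) → wen })
        (λ { (old r) → inj₁ r ; new → inj₂ (inj₁ (refl , refl)) ; wen → inj₂ (inj₂ (refl , refl)) })
        (adj? a b ⊎-dec (a Fin.≟ x ×-dec b Fin.≟ y ⊎-dec a Fin.≟ y ×-dec b Fin.≟ x))

    module _ {x y : Fin n} (x≢y : x ≢ y) where

      degree-addEdge : ∀ z → degree G z ≤ degree (addEdge x≢y) z
      degree-addEdge z = #-mono (adj? z) (Graph.adj? (addEdge x≢y) z) old (allFin n)

      ΣDegree-addEdge : ¬ Adj x y → ΣDegree < ∑ (degree (addEdge x≢y)) (allFin n)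
      ΣDegree-addEdge ¬xy = ∑-mono-< degree-addEdge (∈-allFin x)
        (#-mono-< (adj? x) (Graph.adj? (addEdge x≢y) x) old (∈-allFin y) ¬xy new)

    NonAdj : Rel (Fin n) 0ℓ
    NonAdj x y = x ≢ y × ¬ Adj x y

    -- The bound `k` is lowered until some non-adjacent pair attains it; if it reaches 0, there is
    -- no such pair.
    maxPair : ∀ k → (∀ x y → NonAdj x y → degree G x + degree G y < k) →
      (∀ x y → ¬ NonAdj x y) ⊎
      ∃[ x ] ∃[ y ] NonAdj x y × (∀ a b → NonAdj a b → degree G a + degree G b ≤ degree G x + degree G y)
    maxPair zero    bound = inj₁ λ x y nonAdj → contradiction (bound x y nonAdj) ℕ.n≮0
    maxPair (suc k) bound
      with Fin.any? (λ x → Fin.any? λ y →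
        (¬? (x Fin.≟ y) ×-dec ¬? (adj? x y)) ×-dec k ℕ.≤? degree G x + degree G y)
    ... | yes (x , y , nonAdj , k≤) = inj₂ (x , y , nonAdj , λ a b nonAdj′ →
      ℕ.≤-trans (ℕ.≤-pred (bound a b nonAdj′)) k≤)
    ... | no none = maxPair k λ x y nonAdj → ℕ.≰⇒> λ k≤ → none (x , y , nonAdj , k≤)

  -- Pósa's degree condition for Hamiltonicity, shifted by t. Adding edges preserves it, since each
  -- of the counts can only drop.
  Posa : ∀ {n} → (t δ : ℕ) → Graph n → Set
  Posa {n} t δ G = ∀ i → δ ≤ i → i ≤ h n t → # (λ z → degree G z ℕ.≤? i) (allFin n) < i ∸ t

  module _ {n} (G : Graph n) (t : ℕ) {δ} (δ≤ : ∀ z → δ ≤ degree G z) (posa : Posa t δ G) where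
    open Graph G

    private
      d : Fin n → ℕ
      d = degree G

      -- The vertices not adjacent to y have degree at most d x, by maximality.
      ordered : ∀ x y → NonAdj G x y → (∀ a b → NonAdj G a b → d a + d b ≤ d x + d y) →
                d x ≤ d y → n + t ≤ d x + d y
      ordered x y _ maximal dx≤dy = ℕ.≮⇒≥ λ small →
        contradiction (posa (d x) (δ≤ x) (dx≤h small)) (ℕ.≤⇒≯ (many small))
        where
        open ℕ.≤-Reasoning
        dx≤h : d x + d y < n + t → d x ≤ h n t
        dx≤h small = begin
          d x              ≡⟨ ℕ.m*n/n≡m (d x) 2 ⟨
          d x * 2 ℕ./ 2    ≤⟨ ℕ./-monoˡ-≤ 2 (begin
            d x * 2          ≡⟨ double (d x) ⟩
            d x + d x        ≤⟨ ℕ.+-monoʳ-≤ (d x) dx≤dy ⟩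
            d x + d y        ≤⟨ ℕ.∸-monoˡ-≤ 1 small ⟩
            n + t ∸ 1        ∎) ⟩
          h n t            ∎
          where
          double : ∀ k → k * 2 ≡ k + k
          double = solve-∀
        low? : Decidable (λ z → d z ≤ d x)
        low? z = d z ℕ.≤? d x
        everywhere : ∀ z → Adj y z ⊎ (d z ≤ d x ⊎ z ≡ y)
        everywhere z with adj? y z | z Fin.≟ y
        ... | yes yz | _       = inj₁ yz
        ... | no _   | yes z≡y = inj₂ (inj₂ z≡y)
        ... | no ¬yz | no z≢y  = inj₂ (inj₁ (ℕ.+-cancelʳ-≤ (d y) (d z) (d x) (maximal z y (z≢y , ¬yz ∘ symm))))
        many : d x + d y < n + t → d x ∸ t ≤ # low? (allFin n)
        many small = ℕ.m≤n+o⇒m∸n≤o (d x) t (ℕ.+-cancelʳ-≤ (d y) (d x) (t + # low? (allFin n)) (ℕ.≤-pred (begin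
          suc (d x + d y)
            ≤⟨ small ⟩
          n + t
            ≡⟨ cong (_+ t) (length-allFin G) ⟨
          length (allFin n) + t
            ≤⟨ ℕ.+-monoˡ-≤ t (#-cover (adj? y) (λ z → low? z ⊎-dec z Fin.≟ y) everywhere (allFin n)) ⟩
          d y + # (λ z → low? z ⊎-dec z Fin.≟ y) (allFin n) + t
            ≤⟨ ℕ.+-monoˡ-≤ t (ℕ.+-monoʳ-≤ (d y) (#-⊎ low? (Fin._≟ y) (allFin n))) ⟩
          d y + (# low? (allFin n) + # (Fin._≟ y) (allFin n)) + t
            ≤⟨ ℕ.+-monoˡ-≤ t (ℕ.+-monoʳ-≤ (d y) (ℕ.+-monoʳ-≤ (# low? (allFin n))
                 (#-≡-unique Fin._≟_ y (Unique.allFin⁺ n)))) ⟩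
          d y + (# low? (allFin n) + 1) + t
            ≡⟨ rearrange (d y) (# low? (allFin n)) t ⟩
          suc (t + # low? (allFin n) + d y) ∎)))
          where
          rearrange : ∀ y l t → y + (l + 1) + t ≡ suc (t + l + y)
          rearrange = solve-∀

    posa⇒dense : ∀ x y → NonAdj G x y → (∀ a b → NonAdj G a b → d a + d b ≤ d x + d y) →
                 n + t ≤ d x + d y
    posa⇒dense x y nonAdj@(x≢y , ¬xy) maximal with ℕ.≤-total (d x) (d y)
    ... | inj₁ dx≤dy = ordered x y nonAdj maximal dx≤dy
    ... | inj₂ dy≤dx = subst (n + t ≤_) (ℕ.+-comm (d y) (d x))
      (ordered y x (x≢y ∘ sym , ¬xy ∘ symm)
        (λ a b nonAdj′ → subst (d a + d b ≤_) (ℕ.+-comm (d x) (d y)) (maximal a b nonAdj′)) dy≤dx)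

  module _ {n t δ : ℕ} (us vs : List (Fin n)) (0<us : 0 < length us) (us≡t : length us ≡ t)
           (vs≡t : length vs ≡ t) (uniq : Unique (us ++ vs)) where

    -- `k` is fuel: a degree sum never exceeds n², and each added edge raises it. On the way back
    -- from the complete graph, `removeEdge` gives up the added edges one at a time.
    posa⇒coverable : ∀ k (G : Graph n) → n * n < ΣDegree G + k → (∀ z → δ ≤ degree G z) →
                     Posa t δ G → Coverable (Graph.Adj G) us vs (allFin n)
    posa⇒coverable zero G fuel _ _ = contradiction
      (subst (n * n <_) (ℕ.+-identityʳ (ΣDegree G)) fuel) (ℕ.≤⇒≯ (ΣDegree≤n*n G))
    posa⇒coverable (suc k) G fuel δ≤ posa
      with maxPair G (suc (n + n)) (λ x y _ → s≤s (ℕ.+-mono-≤ (degree≤n G x) (degree≤n G y)))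
    ... | inj₁ complete = completeCoverable
      (λ {a} {b} a≢b → decidable-stable (adj? a b) λ ¬ab → complete a b (a≢b , ¬ab))
      us vs (allFin n) 0<us (≡.trans us≡t (sym vs≡t)) uniq (Unique.allFin⁺ n) ∈-allFin
      where open Graph G
    ... | inj₂ (x , y , nonAdj@(x≢y , ¬xy) , maximal) =
      removeEdge symm (irrefl refl) adj? (Unique.allFin⁺ n)
        (subst (_≤ degree G x + degree G y) (sym (cong₂ _+_ (length-allFin G) us≡t))
          (posa⇒dense G t δ≤ posa x y nonAdj maximal))
        (posa⇒coverable k (addEdge G x≢y)
          (ℕ.<-≤-trans fuel (ℕ.≤-trans (ℕ.≤-reflexive (ℕ.+-suc (ΣDegree G) k))
            (ℕ.+-monoˡ-≤ k (ΣDegree-addEdge G x≢y ¬xy))))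
          (λ z → ℕ.≤-trans (δ≤ z) (degree-addEdge G x≢y z))
          (λ i δ≤i i≤h → ℕ.≤-<-trans
            (#-mono (λ z → degree (addEdge G x≢y) z ℕ.≤? i) (λ z → degree G z ℕ.≤? i)
              (ℕ.≤-trans (degree-addEdge G x≢y _)) (allFin n))
            (posa i δ≤i i≤h)))
      where open Graph G

  -- From the number of edges to the degree condition

  module _ {n δ : ℕ} (G : Graph n) (minDegree : HasMinDegree G δ) where
    open Graph G

    private
      d : Fin n → ℕ
      d = degree G

    -- A vertex of degree exactly δ is put first among those of degree at most i, which improves the
    -- bound (k + 1)i by i - δ. The last summand δ of `g₀` originates here.
    lowVertices : ∀ i k → δ ≤ i → suc k ≤ # (λ z → d z ℕ.≤? i) (allFin n) →
                  ∃[ S ] Unique S × length S ≡ suc k × ∑ d S ≤ δ + k * i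
    lowVertices i k δ≤i k<# = choose (∈-∃++ w∈low)
      where
      w = proj₁ (proj₂ minDegree)
      dw≡δ : d w ≡ δ
      dw≡δ = proj₂ (proj₂ minDegree)
      low : List (Fin n)
      low = filter (λ z → d z ℕ.≤? i) (allFin n)
      w∈low : w ∈ low
      w∈low = ∈-filter⁺ (λ z → d z ℕ.≤? i) (∈-allFin w) (ℕ.≤-trans (ℕ.≤-reflexive dw≡δ) δ≤i)
      choose : (∃[ as ] ∃[ bs ] low ≡ as ++ [ w ] ++ bs) →
               ∃[ S ] Unique S × length S ≡ suc k × ∑ d S ≤ δ + k * i
      choose (as , bs , low≡) = w ∷ take k (as ++ bs) , Unique.take⁺ (suc k) uniq ,
        cong suc length-take ,
        ℕ.+-mono-≤ (ℕ.≤-reflexive dw≡δ) (ℕ.≤-trans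
          (∑-bound (All.take⁺ k (All.tail bounded)))
          (ℕ.≤-reflexive (cong (_* i) length-take)))
        where
        low↭ : low ↭ w ∷ as ++ bs
        low↭ = subst (_↭ w ∷ as ++ bs) (sym low≡) (↭.shift w as bs)
        uniq : Unique (w ∷ as ++ bs)
        uniq = Unique-resp-↭ low↭ (Unique.filter⁺ (λ z → d z ℕ.≤? i) (Unique.allFin⁺ n))
        bounded : All (λ z → d z ≤ i) (w ∷ as ++ bs)
        bounded = ↭.All-resp-↭ low↭ (All.all-filter (λ z → d z ℕ.≤? i) (allFin n))
        length-take : length (take k (as ++ bs)) ≡ k
        length-take = ≡.trans (List.length-take k (as ++ bs))
          (ℕ.m≤n⇒m⊓n≡m (ℕ.≤-pred (subst (suc k ≤_) (↭.↭-length low↭) k<#)))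

    ΣDegree-low : ∀ i k c → n ≡ suc k + c → δ ≤ i → suc k ≤ # (λ z → d z ℕ.≤? i) (allFin n) →
                  ΣDegree G ≤ 2 * (δ + k * i) + c * (c ∸ 1)
    ΣDegree-low i k c n≡ δ≤i k<# with lowVertices i k δ≤i k<#
    ... | S , uniq , |S| , ΣS≤ with unique-⊆⇒↭ S uniq (λ {z} _ → ∈-allFin z)
    ...   | T , ↭S++T = begin
      ΣDegree G
        ≤⟨ degree-sum symm adj? (irrefl refl) S T ↭S++T ⟩
      2 * ∑ d S + length T * (length T ∸ 1)
        ≡⟨ cong (λ m → 2 * ∑ d S + m * (m ∸ 1)) |T| ⟩
      2 * ∑ d S + c * (c ∸ 1)
        ≤⟨ ℕ.+-monoˡ-≤ (c * (c ∸ 1)) (ℕ.*-monoʳ-≤ 2 ΣS≤) ⟩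
      2 * (δ + k * i) + c * (c ∸ 1) ∎
      where
      open ℕ.≤-Reasoning
      |T| : length T ≡ c
      |T| = ℕ.+-cancelˡ-≡ (suc k) (length T) c (≡.trans (cong (_+ length T) (sym |S|)) (≡.trans (sym (List.length-++ S))
          (≡.trans (sym (↭.↭-length ↭S++T)) (≡.trans (length-allFin G) n≡))))

  -- The slacks `a`, `p`, `r`, `m` express t < δ ≤ i ≤ h < n + t additively. Then i - t is a + p + 1
  -- and the remaining vertices number r + m + 1, so the polynomial identities are free of truncated
  -- subtraction.
  module _ (n t a p r m : ℕ) (n+t≡ : n + t ≡ suc t + a + p + r + suc m)
           (h≡ : h n t ≡ suc t + a + p + r) where

    private
      δ i H : ℕ
      δ = suc t + a
      i = δ + p
      H = i + r

      q : ℕ → ℕ → ℕ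
      q x y = (m + y) * suc (m + y) + 2 * ((a + x) * (δ + x))

      -- Doubling turns the binomial coefficient into a product. The term 2δ stems from the chosen
      -- vertex of degree δ; it does not vary with i and is therefore kept out of `q`.
      f₀-value : 2 * δ + q 0 (r + p) ≡ 2 * f₀ n t δ
      f₀-value = begin
        2 * δ + ((m + (r + p)) * suc (m + (r + p)) + 2 * ((a + 0) * (δ + 0)))
          ≡⟨ rearrange a δ (m + (r + p)) ⟩
        suc (m + (r + p)) * (m + (r + p)) + 2 * (suc a * δ)
          ≡⟨ cong (_+ 2 * (suc a * δ)) (2*nC2 (suc (m + (r + p)))) ⟨
        2 * (suc (m + (r + p)) C 2) + 2 * (suc a * δ)
          ≡⟨ ℕ.*-distribˡ-+ 2 (suc (m + (r + p)) C 2) (suc a * δ) ⟨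
        2 * (suc (m + (r + p)) C 2 + suc a * δ)
          ≡⟨ cong₂ (λ x y → 2 * (x C 2 + y * δ)) (sym clique) (sym independent) ⟩
        2 * f₀ n t δ ∎
        where
        open ≡-Reasoning
        rearrange : ∀ a δ c → 2 * δ + (c * suc c + 2 * ((a + 0) * (δ + 0))) ≡ suc c * c + 2 * (suc a * δ)
        rearrange = solve-∀
        split : ∀ δ p r m → δ + p + r + suc m ≡ δ + suc (m + (r + p))
        split = solve-∀
        clique : n + t ∸ δ ≡ suc (m + (r + p))
        clique = ≡.trans (cong (_∸ δ) (≡.trans n+t≡ (split δ p r m))) (ℕ.m+n∸m≡n δ (suc (m + (r + p))))
        independent : δ ∸ t ≡ suc a
        independent = ≡.trans (cong (_∸ t) (sym (ℕ.+-suc t a))) (ℕ.m+n∸m≡n t (suc a))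

      g₀-value : 2 * δ + q (p + r) 0 ≡ 2 * g₀ n t δ
      g₀-value = begin
        2 * δ + ((m + 0) * suc (m + 0) + 2 * ((a + (p + r)) * (δ + (p + r))))
          ≡⟨ rearrange a δ p r m ⟩
        suc m * m + 2 * ((a + (p + r)) * H + δ)
          ≡⟨ cong (_+ 2 * ((a + (p + r)) * H + δ)) (2*nC2 (suc m)) ⟨
        2 * (suc m C 2) + 2 * ((a + (p + r)) * H + δ)
          ≡⟨ ℕ.*-distribˡ-+ 2 (suc m C 2) ((a + (p + r)) * H + δ) ⟨
        2 * (suc m C 2 + ((a + (p + r)) * H + δ))
          ≡⟨ cong (2 *_) (ℕ.+-assoc (suc m C 2) ((a + (p + r)) * H) δ) ⟨
        2 * (suc m C 2 + (a + (p + r)) * H + δ)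
          ≡⟨ cong₂ (λ x y → 2 * (x C 2 + y * H + δ)) (sym clique) (sym independent) ⟩
        2 * ((n + t ∸ H) C 2 + (H ∸ t ∸ 1) * H + δ)
          ≡⟨ cong (λ x → 2 * ((n + t ∸ x) C 2 + (x ∸ t ∸ 1) * x + δ)) h≡ ⟨
        2 * g₀ n t δ ∎
        where
        open ≡-Reasoning
        rearrange : ∀ a δ p r m →
          2 * δ + ((m + 0) * suc (m + 0) + 2 * ((a + (p + r)) * (δ + (p + r)))) ≡
          suc m * m + 2 * ((a + (p + r)) * (δ + p + r) + δ)
        rearrange = solve-∀
        clique : n + t ∸ H ≡ suc m
        clique = ≡.trans (cong (_∸ H) n+t≡) (ℕ.m+n∸m≡n H (suc m))
        split : ∀ t a p r → suc t + a + p + r ≡ t + suc (a + (p + r))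
        split = solve-∀
        independent : H ∸ t ∸ 1 ≡ a + (p + r)
        independent = cong (_∸ 1) (≡.trans (cong (_∸ t) (split t a p r)) (ℕ.m+n∸m≡n t (suc (a + (p + r)))))

    size-bound : 2 * (δ + (a + p) * i) + (r + suc m) * (r + suc m ∸ 1) ≤ 2 * h₀ n t δ
    size-bound = begin
      2 * (δ + (a + p) * i) + (r + suc m) * (r + suc m ∸ 1)
        ≡⟨ cong (λ c → 2 * (δ + (a + p) * i) + c * (c ∸ 1)) (≡.trans (ℕ.+-suc r m) (cong suc (ℕ.+-comm r m))) ⟩
      2 * (δ + (a + p) * i) + suc (m + r) * (m + r)
        ≡⟨ rearrange a δ p (m + r) ⟩
      2 * δ + q p r
        ≤⟨ endpoint (convex m a δ p r) ⟩
      2 * h₀ n t δ ∎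
      where
      open ℕ.≤-Reasoning
      rearrange : ∀ a δ p c → 2 * (δ + (a + p) * (δ + p)) + suc c * c ≡ 2 * δ + (c * suc c + 2 * ((a + p) * (δ + p)))
      rearrange = solve-∀
      endpoint : q p r ≤ q 0 (r + p) ⊎ q p r ≤ q (p + r) 0 → 2 * δ + q p r ≤ 2 * h₀ n t δ
      endpoint (inj₁ ≤f) = begin
        2 * δ + q p r        ≤⟨ ℕ.+-monoʳ-≤ (2 * δ) ≤f ⟩
        2 * δ + q 0 (r + p)  ≡⟨ f₀-value ⟩
        2 * f₀ n t δ         ≤⟨ ℕ.*-monoʳ-≤ 2 (ℕ.m≤m⊔n (f₀ n t δ) (g₀ n t δ)) ⟩
        2 * h₀ n t δ         ∎
      endpoint (inj₂ ≤g) = begin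
        2 * δ + q p r        ≤⟨ ℕ.+-monoʳ-≤ (2 * δ) ≤g ⟩
        2 * δ + q (p + r) 0  ≡⟨ g₀-value ⟩
        2 * g₀ n t δ         ≤⟨ ℕ.*-monoʳ-≤ 2 (ℕ.m≤n⊔m (f₀ n t δ) (g₀ n t δ)) ⟩
        2 * h₀ n t δ         ∎

  module _ {n t δ : ℕ} (4≤2t : 4 ≤ 2 * t) (2t≤δ : 2 * t ≤ δ) where

    private
      0<t : 0 < t
      0<t = ℕ.n≢0⇒n>0 λ { refl → contradiction 4≤2t λ () }

      t<δ : t < δ
      t<δ = ℕ.<-≤-trans (ℕ.m<m*n t 2 {{>-nonZero 0<t}} (s≤s (s≤s z≤n)))
        (ℕ.≤-trans (ℕ.≤-reflexive (ℕ.*-comm t 2)) 2t≤δ)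

      2h<n+t : 2 * h n t < n + t
      2h<n+t = begin-strict
        2 * h n t      ≡⟨ ℕ.*-comm 2 (h n t) ⟩
        h n t * 2      ≤⟨ ℕ.m/n*n≤m (n + t ∸ 1) 2 ⟩
        n + t ∸ 1      <⟨ ℕ.∸-monoʳ-< {n + t} {1} {0} (s≤s z≤n) (ℕ.≤-trans 0<t (ℕ.m≤n+m t n)) ⟩
        n + t          ∎
        where open ℕ.≤-Reasoning

    size⇒posa : (G : Graph n) → HasMinDegree G δ → 2 * h₀ n t δ < ΣDegree G → Posa t δ G
    size⇒posa G minDegree large i δ≤i i≤h = ℕ.≰⇒> λ many →
      contradiction large (ℕ.≤⇒≯ (small (ℕ.m≤n⇒∃[o]m+o≡n t<δ) (ℕ.m≤n⇒∃[o]m+o≡n δ≤i)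
        (ℕ.m≤n⇒∃[o]m+o≡n i≤h) (ℕ.m≤n⇒∃[o]m+o≡n h<n+t) many))
      where
      h<n+t : h n t < n + t
      h<n+t = ℕ.≤-<-trans (ℕ.m≤m+n (h n t) (h n t + 0)) 2h<n+t
      small : (∃[ a ] suc t + a ≡ δ) → (∃[ p ] δ + p ≡ i) → (∃[ r ] i + r ≡ h n t) →
              (∃[ m ] suc (h n t) + m ≡ n + t) → i ∸ t ≤ # (λ z → degree G z ℕ.≤? i) (allFin n) →
              ΣDegree G ≤ 2 * h₀ n t δ
      small (a , refl) (p , refl) (r , h≡) (m , n+t≡) many =
        ℕ.≤-trans (ΣDegree-low G minDegree i (a + p) (r + suc m) n≡ δ≤i
          (subst (_≤ # (λ z → degree G z ℕ.≤? (suc t + a + p)) (allFin n)) i∸t≡ many))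
          (size-bound n t a p r m
            (≡.trans (sym n+t≡) (≡.trans (cong (λ x → suc x + m) (sym h≡)) (sym (ℕ.+-suc _ m)))) (sym h≡))
        where
        split : ∀ t a p → suc t + a + p ≡ t + suc (a + p)
        split = solve-∀
        i∸t≡ : suc t + a + p ∸ t ≡ suc (a + p)
        i∸t≡ = ≡.trans (cong (_∸ t) (split t a p)) (ℕ.m+n∸m≡n t (suc (a + p)))
        rearrange : ∀ t a p r m → suc (suc t + a + p + r) + m ≡ suc (a + p) + (r + suc m) + t
        rearrange = solve-∀
        n≡ : n ≡ suc (a + p) + (r + suc m)
        n≡ = ℕ.+-cancelʳ-≡ t n _ (≡.trans (sym n+t≡) (≡.trans (cong (λ x → suc x + m) (sym h≡)) (rearrange t a p r m)))

    size⇒coverable : (G : Graph n) → HasMinDegree G δ → 2 * h₀ n t δ < ΣDegree G →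
                     ManyToManyDisjointPathCoverable G t
    size⇒coverable G minDegree large = coverable⇒pathCoverable G λ u v uniq →
      posa⇒coverable (tabulate u) (tabulate v)
        (subst (0 <_) (sym (List.length-tabulate u)) 0<t)
        (List.length-tabulate u) (List.length-tabulate v) uniq
        (suc (n * n)) G (ℕ.m≤n+m (suc (n * n)) (ΣDegree G))
        (proj₁ minDegree) (size⇒posa G minDegree large)

    -- This keeps the constant term c of the quadratic nonnegative in the spectral part. Already 2
    -- `f₀` is large enough: with n = δ + a + m + 2 the difference is a sum of products of natural
    -- numbers.
    nδ≤2h₀ : δ ≤ h n t → n * δ ≤ 2 * h₀ n t δ
    nδ≤2h₀ δ≤h = ≤2h₀ (ℕ.m≤n⇒∃[o]m+o≡n t<δ) (ℕ.m≤n⇒∃[o]m+o≡n δ+δ<n+t)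
      where
      δ+δ<n+t : δ + δ < n + t
      δ+δ<n+t = ℕ.≤-<-trans (ℕ.≤-trans (ℕ.+-mono-≤ δ≤h δ≤h)
        (ℕ.+-monoʳ-≤ (h n t) (ℕ.m≤m+n (h n t) 0))) 2h<n+t
      ≤2h₀ : (∃[ a ] suc t + a ≡ δ) → (∃[ m ] suc (δ + δ) + m ≡ n + t) → n * δ ≤ 2 * h₀ n t δ
      ≤2h₀ (a , refl) (m , n+t≡) = begin
        n * δ
          ≡⟨ cong (_* δ) n≡ ⟩
        (a + suc δ + m + 1) * δ
          ≤⟨ ℕ.m≤m+n _ (m * suc (δ + m) + suc a * δ) ⟩
        (a + suc δ + m + 1) * δ + (m * suc (δ + m) + suc a * δ)
          ≡⟨ rearrange a δ m ⟩
        suc (δ + m) * (δ + m) + 2 * (suc a * δ)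
          ≡⟨ cong₂ (λ x y → x * (x ∸ 1) + 2 * (y * δ)) (sym clique) (sym independent) ⟩
        (n + t ∸ δ) * (n + t ∸ δ ∸ 1) + 2 * ((δ ∸ t) * δ)
          ≡⟨ cong (_+ 2 * ((δ ∸ t) * δ)) (2*nC2 (n + t ∸ δ)) ⟨
        2 * ((n + t ∸ δ) C 2) + 2 * ((δ ∸ t) * δ)
          ≡⟨ ℕ.*-distribˡ-+ 2 ((n + t ∸ δ) C 2) ((δ ∸ t) * δ) ⟨
        2 * f₀ n t δ
          ≤⟨ ℕ.*-monoʳ-≤ 2 (ℕ.m≤m⊔n (f₀ n t δ) (g₀ n t δ)) ⟩
        2 * h₀ n t δ ∎
        where
        open ℕ.≤-Reasoning
        n≡ : n ≡ a + suc δ + m + 1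
        n≡ = ℕ.+-cancelʳ-≡ t n _ (≡.trans (sym n+t≡) (r₁ t a m))
          where
          r₁ : ∀ t a m → suc ((suc t + a) + (suc t + a)) + m ≡ a + suc (suc t + a) + m + 1 + t
          r₁ = solve-∀
        rearrange : ∀ a δ m → (a + suc δ + m + 1) * δ + (m * suc (δ + m) + suc a * δ) ≡
          suc (δ + m) * (δ + m) + 2 * (suc a * δ)
        rearrange = solve-∀
        clique : n + t ∸ δ ≡ suc (δ + m)
        clique = ≡.trans (cong (_∸ δ) (≡.trans (sym n+t≡) (r₂ δ m))) (ℕ.m+n∸m≡n δ (suc (δ + m)))
          where
          r₂ : ∀ δ m → suc (δ + δ) + m ≡ δ + suc (δ + m)
          r₂ = solve-∀
        independent : δ ∸ t ≡ suc a
        independent = ≡.trans (cong (_∸ t) (sym (ℕ.+-suc t a))) (ℕ.m+n∸m≡n t (suc a))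

module Spectral where

  open Combinatorics using (#; ∑; ΣDegree; length-allFin; nδ≤2h₀)
  open import Data.Nat.Base as ℕ using (ℕ; zero; suc)
  open import Data.Rational.Base as ℚ using (ℚ; 0ℚ; 1ℚ; ½; ∣_∣; _+_; _*_; _-_; -_; _≤_; _<_)
  open import Tactic.RingSolver using (solve-∀)

  -- Rational arithmetic and finite sums

  ℚ-ring : AlmostCommutativeRing 0ℓ 0ℓ
  ℚ-ring = fromCommutativeRing ℚ.+-*-commutativeRing (λ x → dec⇒maybe (0ℚ ℚ.≟ x))

  open SemiringSum (CommutativeRing.semiring ℚ.+-*-commutativeRing)
    using (∑-comm; ∑-distrib-+; *-distribˡ-sum; *-distribʳ-sum; sum-cong-≗)
    renaming (sum to sumℚ)

  ι : ℕ → ℚ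
  ι k = ℤ.+ k ℚ./ 1

  private
    toℚᵘ-ι : ∀ k → ℚ.toℚᵘ (ι k) ℚᵘ.≃ ℚᵘ.mkℚᵘ (ℤ.+ k) 0
    toℚᵘ-ι k = ℚ.toℚᵘ-fromℚᵘ (ℚᵘ.mkℚᵘ (ℤ.+ k) 0)

  -- Addition of normalised fractions divides by a gcd. On unnormalised representatives with
  -- denominator 1 the identity reduces to one of integers.
  ι-+ : ∀ a b → ι (a ℕ.+ b) ≡ ι a + ι b
  ι-+ a b = ℚ.toℚᵘ-injective (begin
    ℚ.toℚᵘ (ι (a ℕ.+ b))                                ≈⟨ toℚᵘ-ι (a ℕ.+ b) ⟩
    ℚᵘ.mkℚᵘ (ℤ.+ (a ℕ.+ b)) 0
      ≈⟨ ℚᵘ.*≡* (cong (ℤ._* ℤ.1ℤ) (≡.trans (ℤ.pos-+ a b)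
           (sym (cong₂ ℤ._+_ (ℤ.*-identityʳ (ℤ.+ a)) (ℤ.*-identityʳ (ℤ.+ b)))))) ⟩
    ℚᵘ.mkℚᵘ (ℤ.+ a) 0 ℚᵘ.+ ℚᵘ.mkℚᵘ (ℤ.+ b) 0            ≈⟨ ℚᵘ.+-cong (toℚᵘ-ι a) (toℚᵘ-ι b) ⟨
    ℚ.toℚᵘ (ι a) ℚᵘ.+ ℚ.toℚᵘ (ι b)                      ≈⟨ ℚ.toℚᵘ-homo-+ (ι a) (ι b) ⟨
    ℚ.toℚᵘ (ι a + ι b)                                  ∎)
    where open ℚᵘ.≃-Reasoning

  ι-* : ∀ a b → ι (a ℕ.* b) ≡ ι a * ι b
  ι-* zero    b = sym (ℚ.*-zeroˡ (ι b))
  ι-* (suc a) b = begin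
    ι (b ℕ.+ a ℕ.* b)      ≡⟨ ι-+ b (a ℕ.* b) ⟩
    ι b + ι (a ℕ.* b)      ≡⟨ cong (ι b +_) (ι-* a b) ⟩
    ι b + ι a * ι b        ≡⟨ collect (ι a) (ι b) ⟩
    (1ℚ + ι a) * ι b       ≡⟨ cong (_* ι b) (ι-+ 1 a) ⟨
    ι (suc a) * ι b        ∎
    where
    open ≡-Reasoning
    collect : ∀ x y → y + x * y ≡ (1ℚ + x) * y
    collect = solve-∀ ℚ-ring

  0≤ι : ∀ k → 0ℚ ≤ ι k
  0≤ι k = ℚ.nonNegative⁻¹ (ι k) {{ℚ.normalize-nonNeg k 1}}

  0≤+ : ∀ {p q} → 0ℚ ≤ p → 0ℚ ≤ q → 0ℚ ≤ p + q
  0≤+ = ℚ.+-mono-≤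

  0≤* : ∀ {p q} → 0ℚ ≤ p → 0ℚ ≤ q → 0ℚ ≤ p * q
  0≤* {p} {q} 0≤p 0≤q = ℚ.nonNegative⁻¹ (p * q)
    {{ℚ.nonNeg*nonNeg⇒nonNeg p {{ℚ.nonNegative 0≤p}} q {{ℚ.nonNegative 0≤q}}}}

  -- With the ring solver, inequalities reduce to exhibiting a nonnegative gap.
  gap⇒≤ : ∀ {p q} r → 0ℚ ≤ r → q ≡ p + r → p ≤ q
  gap⇒≤ {p} r 0≤r refl = subst (_≤ p + r) (ℚ.+-identityʳ p) (ℚ.+-monoʳ-≤ p 0≤r)

  ≤⇒gap : ∀ {p q} → p ≤ q → 0ℚ ≤ q - p
  ≤⇒gap {p} {q} p≤q = subst (_≤ q - p) (ℚ.+-inverseʳ p) (ℚ.+-monoˡ-≤ (- p) p≤q)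

  ι-mono : ∀ {a b} → a ℕ.≤ b → ι a ≤ ι b
  ι-mono {a} a≤b with ℕ.m≤n⇒∃[o]m+o≡n a≤b
  ... | c , refl = gap⇒≤ (ι c) (0≤ι c) (ι-+ a c)

  *-monoˡ-≤ : ∀ {r p q} → 0ℚ ≤ r → p ≤ q → r * p ≤ r * q
  *-monoˡ-≤ {r} 0≤r = ℚ.*-monoˡ-≤-nonNeg r {{ℚ.nonNegative 0≤r}}

  *-monoʳ-≤ : ∀ {r p q} → 0ℚ ≤ r → p ≤ q → p * r ≤ q * r
  *-monoʳ-≤ {r} 0≤r = ℚ.*-monoʳ-≤-nonNeg r {{ℚ.nonNegative 0≤r}}

  p≤∣p∣ : ∀ p → p ≤ ∣ p ∣
  p≤∣p∣ p with ℚ.≤-total 0ℚ p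
  ... | inj₁ 0≤p = ℚ.≤-reflexive (sym (ℚ.0≤p⇒∣p∣≡p 0≤p))
  ... | inj₂ p≤0 = ℚ.≤-trans p≤0 (ℚ.0≤∣p∣ p)

  sumℚ-mono : ∀ {n} {f g : Fin n → ℚ} → (∀ i → f i ≤ g i) → sumℚ f ≤ sumℚ g
  sumℚ-mono {zero}  f≤g = ℚ.≤-refl
  sumℚ-mono {suc n} f≤g = ℚ.+-mono-≤ (f≤g zero) (sumℚ-mono (f≤g ∘ suc))

  0≤sumℚ : ∀ {n} {f : Fin n → ℚ} → (∀ i → 0ℚ ≤ f i) → 0ℚ ≤ sumℚ f
  0≤sumℚ {zero}  0≤f = ℚ.≤-refl
  0≤sumℚ {suc n} 0≤f = 0≤+ (0≤f zero) (0≤sumℚ (0≤f ∘ suc))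

  ≤sumℚ : ∀ {n} {f : Fin n → ℚ} → (∀ i → 0ℚ ≤ f i) → ∀ i → f i ≤ sumℚ f
  ≤sumℚ {suc n} {f} 0≤f zero    = gap⇒≤ (sumℚ (f ∘ suc)) (0≤sumℚ (0≤f ∘ suc)) refl
  ≤sumℚ {suc n} {f} 0≤f (suc i) = gap⇒≤ (f zero + (sumℚ (f ∘ suc) - f (suc i)))
    (0≤+ (0≤f zero) (≤⇒gap (≤sumℚ (0≤f ∘ suc) i))) (regroup (f zero) (sumℚ (f ∘ suc)) (f (suc i)))
    where
    regroup : ∀ a s b → a + s ≡ b + (a + (s - b))
    regroup = solve-∀ ℚ-ring

  sumℚ-bound : ∀ {n} {f : Fin n → ℚ} {c} → (∀ i → f i ≤ c) → sumℚ f ≤ ι n * c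
  sumℚ-bound {zero}  {f} {c} f≤c = ℚ.≤-reflexive (sym (ℚ.*-zeroˡ c))
  sumℚ-bound {suc n} {f} {c} f≤c = begin
    f zero + sumℚ (f ∘ suc)  ≤⟨ ℚ.+-mono-≤ (f≤c zero) (sumℚ-bound (f≤c ∘ suc)) ⟩
    c + ι n * c              ≡⟨ collect (ι n) c ⟩
    (1ℚ + ι n) * c           ≡⟨ cong (_* c) (ι-+ 1 n) ⟨
    ι (suc n) * c            ∎
    where
    open ℚ.≤-Reasoning
    collect : ∀ x y → y + x * y ≡ (1ℚ + x) * y
    collect = solve-∀ ℚ-ring

  ∣sumℚ∣≤ : ∀ {n} (f : Fin n → ℚ) → ∣ sumℚ f ∣ ≤ sumℚ (∣_∣ ∘ f)
  ∣sumℚ∣≤ {zero}  f = ℚ.≤-refl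
  ∣sumℚ∣≤ {suc n} f = ℚ.≤-trans (ℚ.∣p+q∣≤∣p∣+∣q∣ (f zero) (sumℚ (f ∘ suc)))
    (ℚ.+-monoʳ-≤ ∣ f zero ∣ (∣sumℚ∣≤ (f ∘ suc)))

  sumℚ-zero : ∀ {n} (f : Fin n → ℚ) → (∀ i → f i ≡ 0ℚ) → sumℚ f ≡ 0ℚ
  sumℚ-zero {zero}  f f≡0 = refl
  sumℚ-zero {suc n} f f≡0 = cong₂ _+_ (f≡0 zero) (sumℚ-zero (f ∘ suc) (f≡0 ∘ suc))

  sumℚ-diagonal : ∀ {n} (f g : Fin n → ℚ) j → sumℚ (λ i → f i * (if ⌊ i Fin.≟ j ⌋ then g i else 0ℚ)) ≡ f j * g j
  sumℚ-diagonal {suc n} f g zero = ≡.trans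
    (cong (f zero * g zero +_) (sumℚ-zero (λ i → f (suc i) * 0ℚ) (λ i → ℚ.*-zeroʳ (f (suc i)))))
    (ℚ.+-identityʳ (f zero * g zero))
  sumℚ-diagonal {suc n} f g (suc j) = ≡.trans
    (cong₂ _+_ (ℚ.*-zeroʳ (f zero)) (≡.trans (sum-cong-≗ shift) (sumℚ-diagonal (f ∘ suc) (g ∘ suc) j)))
    (ℚ.+-identityˡ (f (suc j) * g (suc j)))
    where
    shift : ∀ i → f (suc i) * (if ⌊ suc i Fin.≟ suc j ⌋ then g (suc i) else 0ℚ) ≡
                  f (suc i) * (if ⌊ i Fin.≟ j ⌋ then g (suc i) else 0ℚ)
    shift i with i Fin.≟ j
    ... | yes _ = refl
    ... | no _  = refl

  -- The enumeration `f` is arbitrary so that the induction can pass to `f ∘ suc`; taking `id` gives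
  -- `allFin n`.
  sumℚ-filter : ∀ {A : Set} {P : Pred A 0ℓ} (P? : Decidable P) (w : A → ℕ) {n} (f : Fin n → A) →
    sumℚ (λ i → ι (w (f i)) * (if ⌊ P? (f i) ⌋ then 1ℚ else 0ℚ)) ≡ ι (∑ w (filter P? (tabulate f)))
  sumℚ-filter P? w {zero}  f = refl
  sumℚ-filter P? w {suc n} f with P? (f zero)
  ... | yes _ = ≡.trans
    (cong₂ _+_ (ℚ.*-identityʳ (ι (w (f zero)))) (sumℚ-filter P? w (f ∘ suc)))
    (sym (ι-+ (w (f zero)) _))
  ... | no _  = ≡.trans
    (cong₂ _+_ (ℚ.*-zeroʳ (ι (w (f zero)))) (sumℚ-filter P? w (f ∘ suc)))
    (ℚ.+-identityˡ _)

  -- Approximate eigenvectors of nonnegative matrices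

  -- The error up to which the eigenvalue equation holds at a single index of the Cauchy sequences.
  residual : ∀ {n} → (Fin n → Fin n → ℚ) → ℚ → (Fin n → ℚ) → Fin n → ℚ
  residual M μ x i = ∣ sumℚ (λ j → M i j * x j) - μ * x i ∣

  module _ {n} (M : Fin n → Fin n → ℚ) (0≤M : ∀ i j → 0ℚ ≤ M i j) (μ : ℚ) (x : Fin n → ℚ) where

    private
      r : Fin n → ℚ
      r = residual M μ x

    -- The triangle inequality in row i, where nonnegative entries of `M` pass through the absolute
    -- value.
    row-bound : ∀ i → μ * ∣ x i ∣ ≤ sumℚ (λ j → M i j * ∣ x j ∣) + r i
    row-bound i = begin
      μ * ∣ x i ∣
        ≤⟨ *-monoʳ-≤ (ℚ.0≤∣p∣ (x i)) (p≤∣p∣ μ) ⟩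
      ∣ μ ∣ * ∣ x i ∣
        ≡⟨ ℚ.∣p*q∣≡∣p∣*∣q∣ μ (x i) ⟨
      ∣ μ * x i ∣
        ≡⟨ cong ∣_∣ (complement (sumℚ (λ j → M i j * x j)) (μ * x i)) ⟩
      ∣ sumℚ (λ j → M i j * x j) - (sumℚ (λ j → M i j * x j) - μ * x i) ∣
        ≤⟨ ℚ.∣p-q∣≤∣p∣+∣q∣ (sumℚ (λ j → M i j * x j)) (sumℚ (λ j → M i j * x j) - μ * x i) ⟩
      ∣ sumℚ (λ j → M i j * x j) ∣ + r i
        ≤⟨ ℚ.+-monoˡ-≤ (r i) (∣sumℚ∣≤ (λ j → M i j * x j)) ⟩
      sumℚ (λ j → ∣ M i j * x j ∣) + r i
        ≡⟨ cong (_+ r i) (sum-cong-≗ λ j →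
             ≡.trans (ℚ.∣p*q∣≡∣p∣*∣q∣ (M i j) (x j)) (cong (_* ∣ x j ∣) (ℚ.0≤p⇒∣p∣≡p (0≤M i j)))) ⟩
      sumℚ (λ j → M i j * ∣ x j ∣) + r i ∎
      where
      open ℚ.≤-Reasoning
      complement : ∀ s t → t ≡ s - (s - t)
      complement = solve-∀ ℚ-ring

    -- Exchanging the order of summation in the weighted sum of the rows brings in the column sums.
    -- The two weights used later are the all-one and the degree vector.
    weighted-bound : ∀ (w v : Fin n → ℚ) → (∀ i → 0ℚ ≤ w i) → (∀ j → sumℚ (λ i → w i * M i j) ≤ v j) →
      μ * sumℚ (λ i → w i * ∣ x i ∣) ≤ sumℚ (λ j → v j * ∣ x j ∣) + sumℚ (λ i → w i * r i)
    weighted-bound w v 0≤w columns = begin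
      μ * sumℚ (λ i → w i * ∣ x i ∣)
        ≡⟨ *-distribˡ-sum μ (λ i → w i * ∣ x i ∣) ⟩
      sumℚ (λ i → μ * (w i * ∣ x i ∣))
        ≤⟨ sumℚ-mono weighted-row ⟩
      sumℚ (λ i → sumℚ (λ j → w i * M i j * ∣ x j ∣) + w i * r i)
        ≡⟨ ∑-distrib-+ (λ i → sumℚ (λ j → w i * M i j * ∣ x j ∣)) (λ i → w i * r i) ⟩
      sumℚ (λ i → sumℚ (λ j → w i * M i j * ∣ x j ∣)) + R
        ≡⟨ cong (_+ R) (∑-comm (λ i j → w i * M i j * ∣ x j ∣)) ⟩
      sumℚ (λ j → sumℚ (λ i → w i * M i j * ∣ x j ∣)) + R
        ≡⟨ cong (_+ R) (sum-cong-≗ λ j → *-distribʳ-sum ∣ x j ∣ (λ i → w i * M i j)) ⟨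
      sumℚ (λ j → sumℚ (λ i → w i * M i j) * ∣ x j ∣) + R
        ≤⟨ ℚ.+-monoˡ-≤ R (sumℚ-mono λ j → *-monoʳ-≤ (ℚ.0≤∣p∣ (x j)) (columns j)) ⟩
      sumℚ (λ j → v j * ∣ x j ∣) + R ∎
      where
      open ℚ.≤-Reasoning
      R = sumℚ (λ i → w i * r i)
      swapˡ : ∀ a b c → a * (b * c) ≡ b * (a * c)
      swapˡ = solve-∀ ℚ-ring
      weighted-row : ∀ i → μ * (w i * ∣ x i ∣) ≤ sumℚ (λ j → w i * M i j * ∣ x j ∣) + w i * r i
      weighted-row i = begin
        μ * (w i * ∣ x i ∣)
          ≡⟨ swapˡ μ (w i) ∣ x i ∣ ⟩
        w i * (μ * ∣ x i ∣)
          ≤⟨ *-monoˡ-≤ (0≤w i) (row-bound i) ⟩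
        w i * (sumℚ (λ j → M i j * ∣ x j ∣) + r i)
          ≡⟨ ℚ.*-distribˡ-+ (w i) (sumℚ (λ j → M i j * ∣ x j ∣)) (r i) ⟩
        w i * sumℚ (λ j → M i j * ∣ x j ∣) + w i * r i
          ≡⟨ cong (_+ w i * r i) (*-distribˡ-sum (w i) (λ j → M i j * ∣ x j ∣)) ⟩
        sumℚ (λ j → w i * (M i j * ∣ x j ∣)) + w i * r i
          ≡⟨ cong (_+ w i * r i) (sum-cong-≗ λ j → sym (ℚ.*-assoc (w i) (M i j) ∣ x j ∣)) ⟩
        sumℚ (λ j → w i * M i j * ∣ x j ∣) + w i * r i ∎

    -- Since d bounds the column sums of M, columns² says that those of M² − bM
    -- are at most c.
    module _ (d : Fin n → ℚ) (D b c : ℚ) (0≤d : ∀ i → 0ℚ ≤ d i) (d≤D : ∀ i → d i ≤ D)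
             (columns : ∀ j → sumℚ (λ i → 1ℚ * M i j) ≤ d j)
             (columns² : ∀ j → sumℚ (λ i → d i * M i j) ≤ b * d j + c)
             (b≤μ : b ≤ μ) where

      quadratic-bound : ((μ - b) * μ - c) * sumℚ (λ i → ∣ x i ∣) ≤ (D + (μ - b)) * sumℚ (residual M μ x)
      -- The gap consists of the slack of `first` multiplied by μ - b and the slacks of `second` and
      -- `third`; `b≤μ` settles the sign of the multiplier.
      quadratic-bound = gap⇒≤ ((μ - b) * (S + E - μ * Y) + (b * S + c * Y + E′ - μ * S) + (D * E - E′))
        (0≤+ (0≤+ (0≤* (≤⇒gap b≤μ) (≤⇒gap first)) (≤⇒gap second)) (≤⇒gap third))
        (combine μ b c D Y S E E′)
        where
        open ℚ.≤-Reasoning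
        Y = sumℚ (λ i → ∣ x i ∣)
        S = sumℚ (λ i → d i * ∣ x i ∣)
        E = sumℚ r
        E′ = sumℚ (λ i → d i * r i)
        1* : ∀ (f : Fin n → ℚ) → sumℚ (λ i → 1ℚ * f i) ≡ sumℚ f
        1* f = sum-cong-≗ (λ i → ℚ.*-identityˡ (f i))
        first : μ * Y ≤ S + E
        first = begin
          μ * Y                                      ≡⟨ cong (μ *_) (1* (λ i → ∣ x i ∣)) ⟨
          μ * sumℚ (λ i → 1ℚ * ∣ x i ∣)              ≤⟨ weighted-bound (λ _ → 1ℚ) d (λ _ → ℚ.nonNegative⁻¹ 1ℚ) columns ⟩
          S + sumℚ (λ i → 1ℚ * r i)           ≡⟨ cong (S +_) (1* r) ⟩
          S + E                                      ∎
        linear : sumℚ (λ j → (b * d j + c) * ∣ x j ∣) ≡ b * S + c * Y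
        linear = ≡.trans (sum-cong-≗ (λ j → expand b (d j) c ∣ x j ∣))
          (≡.trans (∑-distrib-+ (λ j → b * (d j * ∣ x j ∣)) (λ j → c * ∣ x j ∣))
            (cong₂ _+_ (sym (*-distribˡ-sum b (λ j → d j * ∣ x j ∣))) (sym (*-distribˡ-sum c (λ j → ∣ x j ∣)))))
          where
          expand : ∀ b d c y → (b * d + c) * y ≡ b * (d * y) + c * y
          expand = solve-∀ ℚ-ring
        second : μ * S ≤ b * S + c * Y + E′
        second = ℚ.≤-trans (weighted-bound d (λ j → b * d j + c) 0≤d columns²)
          (ℚ.≤-reflexive (cong (_+ E′) linear))
        third : E′ ≤ D * E
        third = ℚ.≤-trans (sumℚ-mono λ i → *-monoʳ-≤ (ℚ.0≤∣p∣ _) (d≤D i))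
          (ℚ.≤-reflexive (sym (*-distribˡ-sum D r)))
        combine : ∀ μ b c D Y S E E′ → (D + (μ - b)) * E ≡
          ((μ - b) * μ - c) * Y + ((μ - b) * (S + E - μ * Y) + (b * S + c * Y + E′ - μ * S) + (D * E - E′))
        combine = solve-∀ ℚ-ring

  -- The spectral threshold ½ (b + s), where s² = b² + 4c, is the larger root of
  -- λ² − bλ − c; here s is known up to an error and λ exceeds it by p ≥ e.
  module _ (b c s p e : ℚ)
           (0≤c : 0ℚ ≤ c) (0<e : 0ℚ < e) (e≤p : e ≤ p) (-½e≤s : - (½ * e) ≤ s)
           (disc≤ : b * b + (1ℚ + 1ℚ + 1ℚ + 1ℚ) * c ≤ s * s + e * e) where

    private
      0≤e : 0ℚ ≤ e
      0≤e = ℚ.<⇒≤ 0<e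
      0≤p-e : 0ℚ ≤ p - e
      0≤p-e = ≤⇒gap e≤p
      0≤s+½e : 0ℚ ≤ s - - (½ * e)
      0≤s+½e = ≤⇒gap -½e≤s
      0≤½ : 0ℚ ≤ ½
      0≤½ = ℚ.nonNegative⁻¹ ½

    -- By completing the square, the right-hand side is (p + s/2)² - (b² + 4c)/4, which is at least
    -- p(p + s) - e²/4. Since p ≥ e and s ≥ -e/2, this is at least e²/2 - e²/4.
    root-gap : ½ * ½ * (e * e) ≤ (½ * (b + s) + p - b) * (½ * (b + s) + p) - c
    root-gap = gap⇒≤
      (e * ((p - e) + (s - - (½ * e))) + (p - e) * ((p - e) + (s - - (½ * e)) + ½ * e) +
        ½ * ½ * (s * s + e * e - (b * b + (1ℚ + 1ℚ + 1ℚ + 1ℚ) * c)))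
      (0≤+ (0≤+ (0≤* 0≤e (0≤+ 0≤p-e 0≤s+½e)) (0≤* 0≤p-e (0≤+ (0≤+ 0≤p-e 0≤s+½e) (0≤* 0≤½ 0≤e))))
        (0≤* (0≤* 0≤½ 0≤½) (≤⇒gap disc≤)))
      (identity b c s p e)
      where
      identity : ∀ b c s p e → (½ * (b + s) + p - b) * (½ * (b + s) + p) - c ≡
        ½ * ½ * (e * e) + (e * ((p - e) + (s - - (½ * e))) + (p - e) * ((p - e) + (s - - (½ * e)) + ½ * e) +
          ½ * ½ * (s * s + e * e - (b * b + (1ℚ + 1ℚ + 1ℚ + 1ℚ) * c)))
      identity = solve-∀ ℚ-ring

    -- Provides the sign of μ - b for `quadratic-bound`. As s² is nearly b² + 4c with c ≥ 0, s
    -- cannot fall short of b by 2e or more: the identity in the second case would make e²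
    -- nonpositive.
    linear≤root : b ≤ ½ * (b + s) + p
    linear≤root with ℚ.≤-total b (s + (e + e))
    ... | inj₁ b≤ = gap⇒≤ (½ * (s + (e + e) - b) + (p - e)) (0≤+ (0≤* 0≤½ (≤⇒gap b≤)) 0≤p-e) (identity b s p e)
      where
      identity : ∀ b s p e → ½ * (b + s) + p ≡ b + (½ * (s + (e + e) - b) + (p - e))
      identity = solve-∀ ℚ-ring
    ... | inj₂ ≤b = contradiction (ℚ.<-≤-trans 0<e² e²≤0) (ℚ.<-irrefl refl)
      where
      0<e² : 0ℚ < e * e
      0<e² = ℚ.positive⁻¹ (e * e) {{ℚ.pos*pos⇒pos e {{ℚ.positive 0<e}} e {{ℚ.positive 0<e}}}}
      identity : ∀ b c s e → 0ℚ ≡ e * e + ((b - (s + (e + e))) * ((b - (s + (e + e))) + e + (1ℚ + 1ℚ) * (s - - (½ * e)))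
        + (e + e) * ((b - (s + (e + e))) + (1ℚ + 1ℚ) * (s - - (½ * e)))
        + (s * s + e * e - (b * b + (1ℚ + 1ℚ + 1ℚ + 1ℚ) * c)) + (1ℚ + 1ℚ + 1ℚ + 1ℚ) * c)
      identity = solve-∀ ℚ-ring
      0≤β : 0ℚ ≤ b - (s + (e + e))
      0≤β = ≤⇒gap ≤b
      0≤2 : 0ℚ ≤ 1ℚ + 1ℚ
      0≤2 = ℚ.nonNegative⁻¹ (1ℚ + 1ℚ)
      e²≤0 : e * e ≤ 0ℚ
      e²≤0 = gap⇒≤ _
        (0≤+ (0≤+ (0≤+ (0≤* 0≤β (0≤+ (0≤+ 0≤β 0≤e) (0≤* 0≤2 0≤s+½e)))
                       (0≤* (0≤+ 0≤e 0≤e) (0≤+ 0≤β (0≤* 0≤2 0≤s+½e))))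
                  (≤⇒gap disc≤))
             (0≤* (ℚ.nonNegative⁻¹ (1ℚ + 1ℚ + 1ℚ + 1ℚ)) 0≤c))
        (identity b c s e)

  -- Neighbour sums and column sums of the matrix A_α

  module _ {A : Set} (f : A → ℕ) {δ} (δ≤f : ∀ z → δ ℕ.≤ f z) {P : Pred A 0ℓ} (P? : Decidable P) where

    -- Each entry outside `P` contributes at least δ to the whole sum. The terms are arranged to
    -- avoid subtraction.
    ∑-filter-bound : ∀ l → ∑ f (filter P? l) ℕ.+ length l ℕ.* δ ℕ.≤ ∑ f l ℕ.+ # P? l ℕ.* δ
    ∑-filter-bound []      = ℕ.z≤n
    ∑-filter-bound (x ∷ l) with P? x
    ... | yes _ = begin
      (f x ℕ.+ ∑ f (filter P? l)) ℕ.+ (δ ℕ.+ length l ℕ.* δ)   ≡⟨ interchange (f x) (∑ f (filter P? l)) δ (length l ℕ.* δ) ⟩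
      (f x ℕ.+ δ) ℕ.+ (∑ f (filter P? l) ℕ.+ length l ℕ.* δ)   ≤⟨ ℕ.+-monoʳ-≤ (f x ℕ.+ δ) (∑-filter-bound l) ⟩
      (f x ℕ.+ δ) ℕ.+ (∑ f l ℕ.+ # P? l ℕ.* δ)                 ≡⟨ interchange (f x) δ (∑ f l) (# P? l ℕ.* δ) ⟩
      (f x ℕ.+ ∑ f l) ℕ.+ (δ ℕ.+ # P? l ℕ.* δ)                 ∎
      where
      open ℕ.≤-Reasoning
      interchange : ∀ a b c d → (a ℕ.+ b) ℕ.+ (c ℕ.+ d) ≡ (a ℕ.+ c) ℕ.+ (b ℕ.+ d)
      interchange = ℕSolver.solve-∀
    ... | no _ = begin
      ∑ f (filter P? l) ℕ.+ (δ ℕ.+ length l ℕ.* δ)   ≡⟨ swapˡ (∑ f (filter P? l)) δ (length l ℕ.* δ) ⟩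
      δ ℕ.+ (∑ f (filter P? l) ℕ.+ length l ℕ.* δ)   ≤⟨ ℕ.+-mono-≤ (δ≤f x) (∑-filter-bound l) ⟩
      f x ℕ.+ (∑ f l ℕ.+ # P? l ℕ.* δ)               ≡⟨ ℕ.+-assoc (f x) (∑ f l) (# P? l ℕ.* δ) ⟨
      (f x ℕ.+ ∑ f l) ℕ.+ # P? l ℕ.* δ               ∎
      where
      open ℕ.≤-Reasoning
      swapˡ : ∀ a b c → a ℕ.+ (b ℕ.+ c) ≡ b ℕ.+ (a ℕ.+ c)
      swapˡ = ℕSolver.solve-∀

    -- The entry `z` is counted with its own value instead of δ. In the application it is a vertex
    -- outside its own neighbourhood, and it contributes the -1 in the coefficient δ - 1.
    ∑-filter-bound-∉ : ∀ {z l} → z ∈ l → ¬ P z →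
      ∑ f (filter P? l) ℕ.+ f z ℕ.+ length l ℕ.* δ ℕ.≤ ∑ f l ℕ.+ δ ℕ.+ # P? l ℕ.* δ
    ∑-filter-bound-∉ {z} {x ∷ l} (here refl) ¬Pz with P? x
    ... | yes Px = contradiction Px ¬Pz
    ... | no _   = begin
      ∑ f (filter P? l) ℕ.+ f x ℕ.+ (δ ℕ.+ length l ℕ.* δ)       ≡⟨ rearrange (∑ f (filter P? l)) (f x) δ (length l ℕ.* δ) ⟩
      (f x ℕ.+ δ) ℕ.+ (∑ f (filter P? l) ℕ.+ length l ℕ.* δ)     ≤⟨ ℕ.+-monoʳ-≤ (f x ℕ.+ δ) (∑-filter-bound l) ⟩
      (f x ℕ.+ δ) ℕ.+ (∑ f l ℕ.+ # P? l ℕ.* δ)                   ≡⟨ rearrange′ (f x) δ (∑ f l) (# P? l ℕ.* δ) ⟩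
      (f x ℕ.+ ∑ f l) ℕ.+ δ ℕ.+ # P? l ℕ.* δ                     ∎
      where
      open ℕ.≤-Reasoning
      rearrange : ∀ s x d l → s ℕ.+ x ℕ.+ (d ℕ.+ l) ≡ (x ℕ.+ d) ℕ.+ (s ℕ.+ l)
      rearrange = ℕSolver.solve-∀
      rearrange′ : ∀ x d s p → (x ℕ.+ d) ℕ.+ (s ℕ.+ p) ≡ (x ℕ.+ s) ℕ.+ d ℕ.+ p
      rearrange′ = ℕSolver.solve-∀
    ∑-filter-bound-∉ {z} {x ∷ l} (there z∈l) ¬Pz with P? x
    ... | yes _ = begin
      (f x ℕ.+ ∑ f (filter P? l)) ℕ.+ f z ℕ.+ (δ ℕ.+ length l ℕ.* δ)
        ≡⟨ rearrange (f x) (∑ f (filter P? l)) (f z) δ (length l ℕ.* δ) ⟩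
      (f x ℕ.+ δ) ℕ.+ (∑ f (filter P? l) ℕ.+ f z ℕ.+ length l ℕ.* δ)   ≤⟨ ℕ.+-monoʳ-≤ (f x ℕ.+ δ) (∑-filter-bound-∉ z∈l ¬Pz) ⟩
      (f x ℕ.+ δ) ℕ.+ (∑ f l ℕ.+ δ ℕ.+ # P? l ℕ.* δ)                   ≡⟨ rearrange (f x) (∑ f l) δ δ (# P? l ℕ.* δ) ⟨
      (f x ℕ.+ ∑ f l) ℕ.+ δ ℕ.+ (δ ℕ.+ # P? l ℕ.* δ)                   ∎
      where
      open ℕ.≤-Reasoning
      rearrange : ∀ x s z d l → (x ℕ.+ s) ℕ.+ z ℕ.+ (d ℕ.+ l) ≡ (x ℕ.+ d) ℕ.+ (s ℕ.+ z ℕ.+ l)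
      rearrange = ℕSolver.solve-∀
    ... | no _ = begin
      ∑ f (filter P? l) ℕ.+ f z ℕ.+ (δ ℕ.+ length l ℕ.* δ)   ≡⟨ swapˡ (∑ f (filter P? l) ℕ.+ f z) δ (length l ℕ.* δ) ⟩
      δ ℕ.+ (∑ f (filter P? l) ℕ.+ f z ℕ.+ length l ℕ.* δ)   ≤⟨ ℕ.+-mono-≤ (δ≤f x) (∑-filter-bound-∉ z∈l ¬Pz) ⟩
      f x ℕ.+ (∑ f l ℕ.+ δ ℕ.+ # P? l ℕ.* δ)                 ≡⟨ rearrange (f x) (∑ f l) δ (# P? l ℕ.* δ) ⟩
      (f x ℕ.+ ∑ f l) ℕ.+ δ ℕ.+ # P? l ℕ.* δ                 ∎
      where
      open ℕ.≤-Reasoning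
      swapˡ : ∀ a b c → a ℕ.+ (b ℕ.+ c) ≡ b ℕ.+ (a ℕ.+ c)
      swapˡ = ℕSolver.solve-∀
      rearrange : ∀ x s d p → x ℕ.+ (s ℕ.+ d ℕ.+ p) ≡ (x ℕ.+ s) ℕ.+ d ℕ.+ p
      rearrange = ℕSolver.solve-∀

  ∑-const-1 : ∀ {A : Set} (l : List A) → ∑ (λ _ → 1) l ≡ length l
  ∑-const-1 []      = refl
  ∑-const-1 (_ ∷ l) = cong suc (∑-const-1 l)

  module _ {n} (G : Graph n) where
    open Graph G

    private
      d : Fin n → ℕ
      d = degree G

      neighbourSum : (Fin n → ℕ) → Fin n → ℕ
      neighbourSum w j = ∑ w (filter (adj? j) (allFin n))

    rationalDegree rationalAdjacency : Fin n → Fin n → ℚ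
    rationalDegree    i j = if ⌊ i Fin.≟ j ⌋ then ι (d i) else 0ℚ
    rationalAdjacency i j = if ⌊ adj? i j ⌋ then 1ℚ else 0ℚ

    rationalAlpha : ℚ → Fin n → Fin n → ℚ
    rationalAlpha α i j = α * rationalDegree i j + (1ℚ - α) * rationalAdjacency i j

    private
      adjacency-sym : ∀ i j → rationalAdjacency i j ≡ rationalAdjacency j i
      adjacency-sym i j with adj? i j | adj? j i
      ... | yes _ | yes _ = refl
      ... | no _  | no _  = refl
      ... | yes r | no ¬r = contradiction (symm r) ¬r
      ... | no ¬r | yes r = contradiction (symm r) ¬r

    alpha-nonneg : ∀ {α} → 0ℚ ≤ α → α ≤ 1ℚ → ∀ i j → 0ℚ ≤ rationalAlpha α i j
    alpha-nonneg 0≤α α≤1 i j = 0≤+ (0≤* 0≤α degree-nonneg) (0≤* (≤⇒gap α≤1) adjacency-nonneg)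
      where
      degree-nonneg : 0ℚ ≤ rationalDegree i j
      degree-nonneg with i Fin.≟ j
      ... | yes _ = 0≤ι (d i)
      ... | no _  = ℚ.≤-refl
      adjacency-nonneg : 0ℚ ≤ rationalAdjacency i j
      adjacency-nonneg with adj? i j
      ... | yes _ = ℚ.nonNegative⁻¹ 1ℚ
      ... | no _  = ℚ.≤-refl

    column-sum : ∀ α (w : Fin n → ℕ) j → sumℚ (λ i → ι (w i) * rationalAlpha α i j) ≡
      α * (ι (w j) * ι (d j)) + (1ℚ - α) * ι (neighbourSum w j)
    column-sum α w j = begin
      sumℚ (λ i → ι (w i) * rationalAlpha α i j)
        ≡⟨ sum-cong-≗ (λ i → expand (ι (w i)) α (rationalDegree i j) (1ℚ - α) (rationalAdjacency i j)) ⟩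
      sumℚ (λ i → α * (ι (w i) * rationalDegree i j) + (1ℚ - α) * (ι (w i) * rationalAdjacency i j))
        ≡⟨ ∑-distrib-+ (λ i → α * (ι (w i) * rationalDegree i j)) (λ i → (1ℚ - α) * (ι (w i) * rationalAdjacency i j)) ⟩
      sumℚ (λ i → α * (ι (w i) * rationalDegree i j)) + sumℚ (λ i → (1ℚ - α) * (ι (w i) * rationalAdjacency i j))
        ≡⟨ cong₂ _+_ (*-distribˡ-sum α (λ i → ι (w i) * rationalDegree i j))
                     (*-distribˡ-sum (1ℚ - α) (λ i → ι (w i) * rationalAdjacency i j)) ⟨
      α * sumℚ (λ i → ι (w i) * rationalDegree i j) + (1ℚ - α) * sumℚ (λ i → ι (w i) * rationalAdjacency i j)
        ≡⟨ cong₂ (λ x y → α * x + (1ℚ - α) * y)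
             (sumℚ-diagonal (ι ∘ w) (ι ∘ d) j)
             (≡.trans (sum-cong-≗ (λ i → cong (ι (w i) *_) (adjacency-sym i j))) (sumℚ-filter (adj? j) w id)) ⟩
      α * (ι (w j) * ι (d j)) + (1ℚ - α) * ι (neighbourSum w j) ∎
      where
      open ≡-Reasoning
      expand : ∀ w α x β y → w * (α * x + β * y) ≡ α * (w * x) + β * (w * y)
      expand = solve-∀ ℚ-ring

    -- The diagonal contributes αd and the neighbours (1 - α)d, so α cancels.
    column-sum-1 : ∀ α j → sumℚ (λ i → 1ℚ * rationalAlpha α i j) ≡ ι (d j)
    column-sum-1 α j = begin
      sumℚ (λ i → 1ℚ * rationalAlpha α i j)
        ≡⟨ column-sum α (λ _ → 1) j ⟩
      α * (1ℚ * ι (d j)) + (1ℚ - α) * ι (neighbourSum (λ _ → 1) j)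
        ≡⟨ cong (λ k → α * (1ℚ * ι (d j)) + (1ℚ - α) * ι k) (∑-const-1 (filter (adj? j) (allFin n))) ⟩
      α * (1ℚ * ι (d j)) + (1ℚ - α) * ι (d j)
        ≡⟨ average α (ι (d j)) ⟩
      ι (d j) ∎
      where
      open ≡-Reasoning
      average : ∀ α x → α * (1ℚ * x) + (1ℚ - α) * x ≡ x
      average = solve-∀ ℚ-ring

    degree<n : ∀ j → d j ℕ.< n
    degree<n j = subst (d j ℕ.<_) (length-allFin G)
      (List.filter-notAll (adj? j) (allFin n) (Any.map (λ { refl → irrefl refl }) (∈-allFin j)))

    module _ {α : ℚ} (0≤α : 0ℚ ≤ α) (α≤1 : α ≤ 1ℚ) {δ H} (δ≤ : ∀ z → δ ℕ.≤ d z) (small : ΣDegree G ℕ.≤ H) where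

      -- `square` says d² ≤ (n - 1)d and treats the diagonal; `neighbours` bounds the degree sum
      -- over the neighbours by (δ - 1)d + H - (n - 1)δ. The gap is the average of their slacks with
      -- weights α and 1 - α.
      column-sum-degree : ∀ j → sumℚ (λ i → ι (d i) * rationalAlpha α i j) ≤
        (ι δ + α * ι n - α * ι δ - 1ℚ) * ι (d j) + (1ℚ - α) * (ι H - ι n * ι δ + ι δ)
      column-sum-degree j = begin
        sumℚ (λ i → ι (d i) * rationalAlpha α i j)
          ≡⟨ column-sum α d j ⟩
        α * (ι (d j) * ι (d j)) + (1ℚ - α) * ι (neighbourSum d j)
          ≤⟨ gap⇒≤ _ (0≤+ (0≤* 0≤α (≤⇒gap square)) (0≤* (≤⇒gap α≤1) (≤⇒gap neighbours)))
               (identity α (ι n) (ι δ) (ι H) (ι (d j)) (ι (neighbourSum d j))) ⟩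
        (ι δ + α * ι n - α * ι δ - 1ℚ) * ι (d j) + (1ℚ - α) * (ι H - ι n * ι δ + ι δ) ∎
        where
        open ℚ.≤-Reasoning
        square : ι (d j) * ι (d j) + ι (d j) ≤ ι n * ι (d j)
        square = begin
          ι (d j) * ι (d j) + ι (d j)      ≡⟨ cong (_+ ι (d j)) (ι-* (d j) (d j)) ⟨
          ι (d j ℕ.* d j) + ι (d j)        ≡⟨ ι-+ (d j ℕ.* d j) (d j) ⟨
          ι (d j ℕ.* d j ℕ.+ d j)          ≤⟨ ι-mono (ℕ.≤-trans (ℕ.≤-reflexive (ℕ.+-comm (d j ℕ.* d j) (d j)))
                                                (ℕ.*-monoˡ-≤ (d j) (degree<n j))) ⟩
          ι (n ℕ.* d j)                    ≡⟨ ι-* n (d j) ⟩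
          ι n * ι (d j)                    ∎
        neighboursℕ : neighbourSum d j ℕ.+ d j ℕ.+ n ℕ.* δ ℕ.≤ H ℕ.+ δ ℕ.+ d j ℕ.* δ
        neighboursℕ = ℕ.≤-trans
          (subst (λ k → neighbourSum d j ℕ.+ d j ℕ.+ k ℕ.* δ ℕ.≤ ΣDegree G ℕ.+ δ ℕ.+ d j ℕ.* δ)
            (length-allFin G) (∑-filter-bound-∉ d δ≤ (adj? j) (∈-allFin j) (irrefl refl)))
          (ℕ.+-monoˡ-≤ (d j ℕ.* δ) (ℕ.+-monoˡ-≤ δ small))
        ι-3 : ∀ a b c e → ι (a ℕ.+ b ℕ.+ c ℕ.* e) ≡ ι a + ι b + ι c * ι e
        ι-3 a b c e = ≡.trans (ι-+ (a ℕ.+ b) (c ℕ.* e)) (cong₂ _+_ (ι-+ a b) (ι-* c e))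
        neighbours : ι (neighbourSum d j) + ι (d j) + ι n * ι δ ≤ ι H + ι δ + ι (d j) * ι δ
        neighbours = ≡.subst₂ _≤_ (ι-3 (neighbourSum d j) (d j) n δ) (ι-3 H δ (d j) δ) (ι-mono neighboursℕ)
        identity : ∀ α n δ H d B → (δ + α * n - α * δ - 1ℚ) * d + (1ℚ - α) * (H - n * δ + δ) ≡
          α * (d * d) + (1ℚ - α) * B +
            (α * (n * d - (d * d + d)) + (1ℚ - α) * (H + δ + d * δ - (B + d + n * δ)))
        identity = solve-∀ ℚ-ring

  -- Properties that hold from some index on

  Eventually : (ℕ → Set) → Set
  Eventually P = ∃[ N ] (∀ k → N ℕ.≤ k → P k)

  always : ∀ {P : ℕ → Set} → (∀ k → P k) → Eventually P
  always p = 0 , λ k _ → p k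

  mapᴱ : ∀ {P Q : ℕ → Set} → (∀ k → P k → Q k) → Eventually P → Eventually Q
  mapᴱ f (N , p) = N , λ k N≤k → f k (p k N≤k)

  _∧ᴱ_ : ∀ {P Q : ℕ → Set} → Eventually P → Eventually Q → Eventually (λ k → P k × Q k)
  (M , p) ∧ᴱ (N , q) = M ℕ.⊔ N , λ k M⊔N≤k →
    p k (ℕ.m⊔n≤o⇒m≤o M N M⊔N≤k) , q k (ℕ.m⊔n≤o⇒n≤o M N M⊔N≤k)

  -- Finitely many thresholds have a maximum. This makes the residuals of all rows small at a common
  -- index.
  allᴱ : ∀ {n} {P : Fin n → ℕ → Set} → (∀ i → Eventually (P i)) → Eventually (λ k → ∀ i → P i k)
  allᴱ {zero}  p = always λ k ()
  allᴱ {suc n} p = mapᴱ (λ { k (p₀ , pₛ) zero → p₀ ; k (p₀ , pₛ) (suc i) → pₛ i }) (p zero ∧ᴱ allᴱ (p ∘ suc))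

  -- Null and bounded sequences

  Null : (ℕ → ℚ) → Set
  Null f = ∀ ε → 0ℚ < ε → Eventually (λ k → ∣ f k ∣ < ε)

  Bounded : (ℕ → ℚ) → Set
  Bounded f = Σ[ B ∈ ℚ ] 0ℚ < B × Eventually (λ k → ∣ f k ∣ ≤ B)

  0<* : ∀ {p q} → 0ℚ < p → 0ℚ < q → 0ℚ < p * q
  0<* {p} {q} 0<p 0<q = ℚ.positive⁻¹ (p * q) {{ℚ.pos*pos⇒pos p {{ℚ.positive 0<p}} q {{ℚ.positive 0<q}}}}

  0<½ : 0ℚ < ½
  0<½ = ℚ.positive⁻¹ ½

  halves : ∀ ε → ½ * ε + ½ * ε ≡ ε
  halves = solve-∀ ℚ-ring

  null-≗ : ∀ {f g : ℕ → ℚ} → (∀ k → f k ≡ g k) → Null f → Null g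
  null-≗ f≗g nf ε 0<ε = mapᴱ (λ k → subst (λ q → ∣ q ∣ < ε) (f≗g k)) (nf ε 0<ε)

  null-+ : ∀ {f g : ℕ → ℚ} → Null f → Null g → Null (λ k → f k + g k)
  null-+ {f} {g} nf ng ε 0<ε = mapᴱ
    (λ { k (p , q) → ℚ.≤-<-trans (ℚ.∣p+q∣≤∣p∣+∣q∣ (f k) (g k))
      (subst (∣ f k ∣ + ∣ g k ∣ <_) (halves ε) (ℚ.+-mono-< p q)) })
    (nf (½ * ε) (0<* 0<½ 0<ε) ∧ᴱ ng (½ * ε) (0<* 0<½ 0<ε))

  null-neg : ∀ {f : ℕ → ℚ} → Null f → Null (λ k → - f k)
  null-neg {f} nf ε 0<ε = mapᴱ (λ k → subst (_< ε) (sym (ℚ.∣-p∣≡∣p∣ (f k)))) (nf ε 0<ε)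

  scaled : ∀ B (0<B : 0ℚ < B) ε → 0ℚ < ε → Σ[ η ∈ ℚ ] 0ℚ < η × η * B ≡ ε
  scaled B 0<B ε 0<ε = ε * (ℚ.1/ B) , 0<* 0<ε (ℚ.positive⁻¹ (ℚ.1/ B) {{ℚ.1/pos⇒pos B}}) ,
    ≡.trans (ℚ.*-assoc ε (ℚ.1/ B) B) (≡.trans (cong (ε *_) (ℚ.*-inverseˡ B)) (ℚ.*-identityʳ ε))
    where
    instance
      B-pos : ℚ.Positive B
      B-pos = ℚ.positive 0<B
      B-nonZero : ℚ.NonZero B
      B-nonZero = ℚ.pos⇒nonZero B

  null-* : ∀ {f g : ℕ → ℚ} → Null f → Bounded g → Null (λ k → f k * g k)
  null-* {f} {g} nf (B , 0<B , g≤B) ε 0<ε with scaled B 0<B ε 0<ε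
  ... | η , 0<η , ηB≡ε = mapᴱ
    (λ { k (fk<η , gk≤B) → begin-strict
      ∣ f k * g k ∣      ≡⟨ ℚ.∣p*q∣≡∣p∣*∣q∣ (f k) (g k) ⟩
      ∣ f k ∣ * ∣ g k ∣  ≤⟨ *-monoˡ-≤ (ℚ.0≤∣p∣ (f k)) gk≤B ⟩
      ∣ f k ∣ * B        <⟨ ℚ.*-monoˡ-<-pos B {{ℚ.positive 0<B}} fk<η ⟩
      η * B              ≡⟨ ηB≡ε ⟩
      ε                  ∎ })
    (nf η 0<η ∧ᴱ g≤B)
    where open ℚ.≤-Reasoning

  bounded : ∀ x → Bounded (seq x)
  bounded x with cauchy x 1ℚ (ℚ.positive⁻¹ 1ℚ)
  ... | N , p = 1ℚ + ∣ seq x N ∣ , ℚ.+-mono-<-≤ (ℚ.positive⁻¹ 1ℚ) (ℚ.0≤∣p∣ (seq x N)) , N , λ k N≤k → begin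
    ∣ seq x k ∣                            ≡⟨ cong ∣_∣ (complement (seq x k) (seq x N)) ⟩
    ∣ (seq x k - seq x N) + seq x N ∣      ≤⟨ ℚ.∣p+q∣≤∣p∣+∣q∣ (seq x k - seq x N) (seq x N) ⟩
    ∣ seq x k - seq x N ∣ + ∣ seq x N ∣    ≤⟨ ℚ.+-monoˡ-≤ ∣ seq x N ∣ (ℚ.<⇒≤ (p k N N≤k ℕ.≤-refl)) ⟩
    1ℚ + ∣ seq x N ∣                       ∎
    where
    open ℚ.≤-Reasoning
    complement : ∀ a b → a ≡ (a - b) + b
    complement = solve-∀ ℚ-ring

  -- Congruence of the real operations

  ≈-refl : ∀ {x} → x ≈ x
  ≈-refl {x} ε 0<ε = always λ k → subst (λ q → ∣ q ∣ < ε) (sym (ℚ.+-inverseʳ (seq x k))) 0<ε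

  ≈-sym : ∀ {x y} → x ≈ y → y ≈ x
  ≈-sym {x} {y} x≈y = null-≗ (λ k → flip (seq x k) (seq y k)) (null-neg x≈y)
    where
    flip : ∀ a b → - (a - b) ≡ b - a
    flip = solve-∀ ℚ-ring

  ≈-trans : ∀ {x y z} → x ≈ y → y ≈ z → x ≈ z
  ≈-trans {x} {y} {z} x≈y y≈z = null-≗ (λ k → telescope (seq x k) (seq y k) (seq z k)) (null-+ x≈y y≈z)
    where
    telescope : ∀ a b c → (a - b) + (b - c) ≡ a - c
    telescope = solve-∀ ℚ-ring

  +ℝ-cong : ∀ {x x′ y y′} → x ≈ x′ → y ≈ y′ → x +ℝ y ≈ x′ +ℝ y′
  +ℝ-cong {x} {x′} {y} {y′} x≈ y≈ =
    null-≗ (λ k → regroup (seq x k) (seq x′ k) (seq y k) (seq y′ k)) (null-+ x≈ y≈)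
    where
    regroup : ∀ a a′ b b′ → (a - a′) + (b - b′) ≡ (a + b) - (a′ + b′)
    regroup = solve-∀ ℚ-ring

  -ℝ-cong : ∀ {x x′ y y′} → x ≈ x′ → y ≈ y′ → x -ℝ y ≈ x′ -ℝ y′
  -ℝ-cong {x} {x′} {y} {y′} x≈ y≈ =
    null-≗ (λ k → regroup (seq x k) (seq x′ k) (seq y k) (seq y′ k)) (null-+ x≈ (null-neg y≈))
    where
    regroup : ∀ a a′ b b′ → (a - a′) + - (b - b′) ≡ (a - b) - (a′ - b′)
    regroup = solve-∀ ℚ-ring

  *ℝ-cong : ∀ {x x′ y y′} → x ≈ x′ → y ≈ y′ → x *ℝ y ≈ x′ *ℝ y′
  *ℝ-cong {x} {x′} {y} {y′} x≈ y≈ =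
    null-≗ (λ k → regroup (seq x k) (seq x′ k) (seq y k) (seq y′ k))
      (null-+ (null-* x≈ (bounded y)) (null-* y≈ (bounded x′)))
    where
    regroup : ∀ a a′ b b′ → (a - a′) * b + (b - b′) * a′ ≡ a * b - a′ * b′
    regroup = solve-∀ ℚ-ring

  sum-cong : ∀ {n} {f g : Fin n → ℝ} → (∀ i → f i ≈ g i) → sum f ≈ sum g
  sum-cong {zero}          f≈g = ≈-refl {0ℝ}
  sum-cong {suc n} {f} {g} f≈g =
    +ℝ-cong {f zero} {g zero} {sum (f ∘ suc)} {sum (g ∘ suc)} (f≈g zero) (sum-cong (f≈g ∘ suc))

  seq-sum : ∀ {n} (f : Fin n → ℝ) k → seq (sum f) k ≡ sumℚ (λ i → seq (f i) k)
  seq-sum {zero}  f k = refl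
  seq-sum {suc n} f k = cong (seq (f zero) k +_) (seq-sum (f ∘ suc) k)

  -- `0ℝ ≤ℝ x` is a negation and yields no bound by itself. But comparing one rational term with
  -- -ε/2 is decidable, and later terms differ from it by less than ε/4: either all stay above -ε,
  -- or all are at most -ε/4, which would make x negative.
  0≤ℝ⇒eventually : ∀ {x} → 0ℝ ≤ℝ x → ∀ ε → 0ℚ < ε → Eventually (λ k → - ε ≤ seq x k)
  0≤ℝ⇒eventually {x} 0≤x ε 0<ε with cauchy x (½ * ½ * ε) (0<* (0<* 0<½ 0<½) 0<ε)
  ... | N , p with ℚ.≤-total (- (½ * ε)) (seq x N)
  ...   | inj₁ ≤xN = N , λ k N≤k → gap⇒≤ _
          (0≤+ (0≤+ (≤⇒gap ≤xN) (≤⇒gap (∣∣<⇒≤ (p N k ℕ.≤-refl N≤k)))) (ℚ.<⇒≤ (0<* (0<* 0<½ 0<½) 0<ε)))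
          (identity ε (seq x N) (seq x k))
    where
    ∣∣<⇒≤ : ∀ {q η} → ∣ q ∣ < η → q ≤ η
    ∣∣<⇒≤ {q} q<η = ℚ.≤-trans (p≤∣p∣ q) (ℚ.<⇒≤ q<η)
    identity : ∀ ε a b → b ≡ - ε + (((a - - (½ * ε)) + (½ * ½ * ε - (a - b))) + ½ * ½ * ε)
    identity = solve-∀ ℚ-ring
  ...   | inj₂ xN≤ = contradiction (½ * ½ * ε , 0<* (0<* 0<½ 0<½) 0<ε , N , λ k N≤k → gap⇒≤ _
          (0≤+ (≤⇒gap xN≤) (≤⇒gap (ℚ.≤-trans (p≤∣p∣ _) (ℚ.<⇒≤ (p k N N≤k ℕ.≤-refl)))))
          (identity ε (seq x N) (seq x k))) 0≤x
    where
    identity : ∀ ε a b → 0ℚ ≡ b + ½ * ½ * ε + ((- (½ * ε) - a) + (½ * ½ * ε - (b - a)))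
    identity = solve-∀ ℚ-ring

  private
    ∣p⊔0-q⊔0∣≤ : ∀ p q → ∣ (p ℚ.⊔ 0ℚ) - (q ℚ.⊔ 0ℚ) ∣ ≤ ∣ p - q ∣
    ∣p⊔0-q⊔0∣≤ p q with ℚ.≤-total p 0ℚ | ℚ.≤-total q 0ℚ
    ... | inj₁ p≤0 | inj₁ q≤0 rewrite ℚ.p≤q⇒p⊔q≡q p≤0 | ℚ.p≤q⇒p⊔q≡q q≤0 = ℚ.0≤∣p∣ (p - q)
    ... | inj₂ 0≤p | inj₂ 0≤q rewrite ℚ.p≥q⇒p⊔q≡p 0≤p | ℚ.p≥q⇒p⊔q≡p 0≤q = ℚ.≤-refl
    ... | inj₂ 0≤p | inj₁ q≤0 rewrite ℚ.p≥q⇒p⊔q≡p 0≤p | ℚ.p≤q⇒p⊔q≡q q≤0 = begin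
      ∣ p - 0ℚ ∣  ≡⟨ cong ∣_∣ (ℚ.+-identityʳ p) ⟩
      ∣ p ∣       ≡⟨ ℚ.0≤p⇒∣p∣≡p 0≤p ⟩
      p           ≤⟨ gap⇒≤ (0ℚ - q) (≤⇒gap q≤0) (identity p q) ⟩
      p - q       ≤⟨ p≤∣p∣ (p - q) ⟩
      ∣ p - q ∣   ∎
      where
      open ℚ.≤-Reasoning
      identity : ∀ p q → p - q ≡ p + (0ℚ - q)
      identity = solve-∀ ℚ-ring
    ... | inj₁ p≤0 | inj₂ 0≤q rewrite ℚ.p≤q⇒p⊔q≡q p≤0 | ℚ.p≥q⇒p⊔q≡p 0≤q = begin
      ∣ 0ℚ - q ∣     ≡⟨ cong ∣_∣ (ℚ.+-identityˡ (- q)) ⟩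
      ∣ - q ∣        ≡⟨ ℚ.∣-p∣≡∣p∣ q ⟩
      ∣ q ∣          ≡⟨ ℚ.0≤p⇒∣p∣≡p 0≤q ⟩
      q              ≤⟨ gap⇒≤ (0ℚ - p) (≤⇒gap p≤0) (identity p q) ⟩
      - (p - q)      ≤⟨ p≤∣p∣ (- (p - q)) ⟩
      ∣ - (p - q) ∣  ≡⟨ ℚ.∣-p∣≡∣p∣ (p - q) ⟩
      ∣ p - q ∣      ∎
      where
      open ℚ.≤-Reasoning
      identity : ∀ p q → - (p - q) ≡ q + (0ℚ - p)
      identity = solve-∀ ℚ-ring

  positivePart : ℝ → ℝ
  positivePart x .seq k         = seq x k ℚ.⊔ 0ℚ
  positivePart x .cauchy ε 0<ε with cauchy x ε 0<ε
  ... | N , p = N , λ k l N≤k N≤l → ℚ.≤-<-trans (∣p⊔0-q⊔0∣≤ (seq x k) (seq x l)) (p k l N≤k N≤l)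

  -- A nonnegative real may have negative terms, but eventually none below -ε/2, so clipping at 0
  -- moves a term by less than ε.
  positivePart-≈ : ∀ {x} → 0ℝ ≤ℝ x → x ≈ positivePart x
  positivePart-≈ {x} 0≤x ε 0<ε = mapᴱ (λ k → close (seq x k)) (0≤ℝ⇒eventually {x} 0≤x (½ * ε) (0<* 0<½ 0<ε))
    where
    open ℚ.≤-Reasoning
    close : ∀ q → - (½ * ε) ≤ q → ∣ q - (q ℚ.⊔ 0ℚ) ∣ < ε
    close q ≤q with ℚ.≤-total q 0ℚ
    ... | inj₂ 0≤q rewrite ℚ.p≥q⇒p⊔q≡p 0≤q | ℚ.+-inverseʳ q = 0<ε
    ... | inj₁ q≤0 rewrite ℚ.p≤q⇒p⊔q≡q q≤0 | ℚ.+-identityʳ q = begin-strict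
      ∣ q ∣      ≡⟨ ℚ.∣-p∣≡∣p∣ q ⟨
      ∣ - q ∣    ≡⟨ ℚ.0≤p⇒∣p∣≡p (ℚ.neg-antimono-≤ q≤0) ⟩
      - q        ≤⟨ gap⇒≤ (q - - (½ * ε)) (≤⇒gap ≤q) (identity q (½ * ε)) ⟩
      ½ * ε      <⟨ ℚ.≤-<-trans (ℚ.≤-reflexive (sym (ℚ.+-identityʳ (½ * ε)))) (ℚ.+-monoʳ-< (½ * ε) (0<* 0<½ 0<ε)) ⟩
      ½ * ε + ½ * ε  ≡⟨ halves ε ⟩
      ε          ∎
      where
      identity : ∀ q e → e ≡ - q + (q - - e)
      identity = solve-∀ ℚ-ring

  -- Vanishing of eigenvectors above the threshold

  module _ {n t δ} (G : Graph n) (δ≤ : ∀ z → δ ℕ.≤ degree G z) (nδ≤2h₀ : n ℕ.* δ ℕ.≤ 2 ℕ.* h₀ n t δ)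
           (small : ΣDegree G ℕ.≤ 2 ℕ.* h₀ n t δ) where

    module _ (α b s p e : ℚ) (0≤α : 0ℚ ≤ α) (α≤1 : α ≤ 1ℚ) (b≡ : b ≡ ι δ + α * ι n - α * ι δ - 1ℚ)
             (0<e : 0ℚ < e) (e≤p : e ≤ p) (-½e≤s : - (½ * e) ≤ s)
             (disc≤ : b * b + ι 4 * (1ℚ - α) * (ι 2 * ι (h₀ n t δ) - ι n * ι δ + ι δ) ≤ s * s + e * e)
             where

      private
        c : ℚ
        c = (1ℚ - α) * (ι (2 ℕ.* h₀ n t δ) - ι n * ι δ + ι δ)

        0≤c : 0ℚ ≤ c
        0≤c = 0≤* (≤⇒gap α≤1) (0≤+ (≤⇒gap (subst (_≤ ι (2 ℕ.* h₀ n t δ)) (ι-* n δ) (ι-mono nδ≤2h₀))) (0≤ι δ))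

        disc≤′ : b * b + (1ℚ + 1ℚ + 1ℚ + 1ℚ) * c ≤ s * s + e * e
        disc≤′ = ℚ.≤-trans (ℚ.≤-reflexive (cong (b * b +_) (begin
          ι 4 * ((1ℚ - α) * (ι (2 ℕ.* h₀ n t δ) - ι n * ι δ + ι δ))
            ≡⟨ ℚ.*-assoc (ι 4) (1ℚ - α) (ι (2 ℕ.* h₀ n t δ) - ι n * ι δ + ι δ) ⟨
          ι 4 * (1ℚ - α) * (ι (2 ℕ.* h₀ n t δ) - ι n * ι δ + ι δ)
            ≡⟨ cong (λ x → ι 4 * (1ℚ - α) * (x - ι n * ι δ + ι δ)) (ι-* 2 (h₀ n t δ)) ⟩
          ι 4 * (1ℚ - α) * (ι 2 * ι (h₀ n t δ) - ι n * ι δ + ι δ) ∎))) disc≤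
          where open ≡-Reasoning

      eigenvector-bound : ∀ μ (x : Fin n → ℚ) → μ ≡ ½ * (b + s) + p →
        ½ * ½ * (e * e) * sumℚ (λ i → ∣ x i ∣) ≤ (ι n + (μ - b)) * sumℚ (residual (rationalAlpha G α) μ x)
      eigenvector-bound μ x refl = ℚ.≤-trans
        (*-monoʳ-≤ (0≤sumℚ λ i → ℚ.0≤∣p∣ (x i)) (root-gap b c s p e 0≤c 0<e e≤p -½e≤s disc≤′))
        (quadratic-bound (rationalAlpha G α) (alpha-nonneg G 0≤α α≤1) μ x
          (ι ∘ degree G) (ι n) b c (0≤ι ∘ degree G) (ι-mono ∘ ℕ.<⇒≤ ∘ degree<n G)
          (ℚ.≤-reflexive ∘ column-sum-1 G α)
          (λ j → subst (λ b → sumℚ (λ i → ι (degree G i) * rationalAlpha G α i j) ≤ b * ι (degree G j) + c) (sym b≡)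
            (column-sum-degree G 0≤α α≤1 δ≤ small j))
          (linear≤root b c s p e 0≤c 0<e e≤p -½e≤s disc≤′))

    private
      module _ (e K ε : ℚ) (0<e : 0ℚ < e) (0<K : 0ℚ < K) (0<ε : 0ℚ < ε) where

        -- `κ` is the lower bound from `root-gap`. The factor (n + K)n is what residuals below η get
        -- multiplied by; the added 1 makes `T` positive and the final estimate strict.
        κ T : ℚ
        κ = ½ * ½ * (e * e)
        T = (ι n + K) * ι n + 1ℚ

        0<κ : 0ℚ < κ
        0<κ = 0<* (0<* 0<½ 0<½) (0<* 0<e 0<e)

        tolerance : Σ[ η ∈ ℚ ] 0ℚ < η × η * T ≡ κ * ε
        tolerance = scaled T (ℚ.+-mono-≤-< (0≤* (0≤+ (0≤ι n) (ℚ.<⇒≤ 0<K)) (0≤ι n)) (ℚ.positive⁻¹ 1ℚ))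
          (κ * ε) (0<* 0<κ 0<ε)

        -- The single number `e` is the margin of μ above the threshold, halved it is the tolerance
        -- for the sign of s, and squared it is the tolerance for s².
        entries-small : ∀ {η} → 0ℚ < η → η * T ≡ κ * ε → ∀ {α b s μ D x} →
          0ℚ ≤ α → b ≡ ι δ + α * ι n - α * ι δ - 1ℚ →
          D ≡ b * b + ι 4 * (1ℚ - α) * (ι 2 * ι (h₀ n t δ) - ι n * ι δ + ι δ) →
          α ≤ 1ℚ → ½ * (b + s) + e ≤ μ → - (½ * e) ≤ s → ∣ s * s - D ∣ < e * e → ∣ μ - b ∣ ≤ K →
          (∀ j → residual (rationalAlpha G α) μ x j < η) → ∀ i → ∣ x i ∣ < ε
        entries-small {η} 0<η ηT≡ {α} {b} {s} {μ} {D} {x} 0≤α b≡ refl α≤1 above -½e≤s disc≤ ≤K res i =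
          ℚ.*-cancelˡ-<-nonNeg κ {{ℚ.pos⇒nonNeg κ {{ℚ.positive 0<κ}}}} (begin-strict
            κ * ∣ x i ∣
              ≤⟨ *-monoˡ-≤ (ℚ.<⇒≤ 0<κ) (≤sumℚ (λ j → ℚ.0≤∣p∣ (x j)) i) ⟩
            κ * sumℚ (λ j → ∣ x j ∣)
              ≤⟨ eigenvector-bound α b s (μ - ½ * (b + s)) e 0≤α α≤1 b≡ 0<e e≤p -½e≤s disc≤′ μ x
                   (complement μ (½ * (b + s))) ⟩
            (ι n + (μ - b)) * R
              ≤⟨ *-monoʳ-≤ 0≤R (ℚ.+-monoʳ-≤ (ι n) (ℚ.≤-trans (p≤∣p∣ (μ - b)) ≤K)) ⟩
            (ι n + K) * R
              ≤⟨ *-monoˡ-≤ (0≤+ (0≤ι n) (ℚ.<⇒≤ 0<K)) (sumℚ-bound (λ j → ℚ.<⇒≤ (res j))) ⟩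
            (ι n + K) * (ι n * η)
              <⟨ ℚ.≤-<-trans (ℚ.≤-reflexive (sym (ℚ.+-identityʳ ((ι n + K) * (ι n * η)))))
                   (ℚ.+-monoʳ-< ((ι n + K) * (ι n * η)) 0<η) ⟩
            (ι n + K) * (ι n * η) + η
              ≡⟨ collect (ι n) K η ⟩
            η * T
              ≡⟨ ηT≡ ⟩
            κ * ε ∎)
          where
          open ℚ.≤-Reasoning
          R = sumℚ (residual (rationalAlpha G α) μ x)
          0≤R : 0ℚ ≤ R
          0≤R = 0≤sumℚ λ j → ℚ.0≤∣p∣ (sumℚ (λ l → rationalAlpha G α j l * x l) - μ * x j)
          complement : ∀ m r → m ≡ r + (m - r)
          complement = solve-∀ ℚ-ring
          collect : ∀ n K η → (n + K) * (n * η) + η ≡ η * ((n + K) * n + 1ℚ)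
          collect = solve-∀ ℚ-ring
          e≤p : e ≤ μ - ½ * (b + s)
          e≤p = gap⇒≤ (μ - (½ * (b + s) + e)) (≤⇒gap above) (identity μ (½ * (b + s)) e)
            where
            identity : ∀ m r e → m - r ≡ e + (m - (r + e))
            identity = solve-∀ ℚ-ring
          disc≤′ : D ≤ s * s + e * e
          disc≤′ = gap⇒≤ (e * e - - (s * s - D))
            (≤⇒gap (ℚ.≤-trans (p≤∣p∣ (- (s * s - D)))
              (ℚ.≤-trans (ℚ.≤-reflexive (ℚ.∣-p∣≡∣p∣ (s * s - D))) (ℚ.<⇒≤ disc≤))))
            (identity (s * s) D (e * e))
            where
            identity : ∀ q d e → q + e ≡ d + (e - - (q - d))
            identity = solve-∀ ℚ-ring

    seq-alphaMatrix : ∀ α i j k → seq (alphaMatrix G α i j) k ≡ rationalAlpha G (seq α k) i j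
    seq-alphaMatrix α i j k with i Fin.≟ j | Graph.adj? G i j
    ... | yes _ | yes _ = refl
    ... | yes _ | no _  = refl
    ... | no _  | yes _ = refl
    ... | no _  | no _  = refl

    -- l and D stand for the linear term and the discriminant, kept as variables
    -- because comparing their unfoldings makes type checking infeasible.
    module _ (α l D μ s : ℝ) (x : Fin n → ℝ) (0≤α : ∀ k → 0ℚ ≤ seq α k) (α≤1 : Eventually (λ k → seq α k ≤ 1ℚ))
             (l≡ : ∀ k → seq l k ≡ ι δ + seq α k * ι n - seq α k * ι δ - 1ℚ)
             (D≡ : ∀ k → seq D k ≡ seq l k * seq l k +
               ι 4 * (1ℚ - seq α k) * (ι 2 * ι (h₀ n t δ) - ι n * ι δ + ι δ))
             (eigen : ∀ i → sum (λ j → alphaMatrix G α i j *ℝ x j) ≈ μ *ℝ x i)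
             (0≤s : 0ℝ ≤ℝ s) (s² : s *ℝ s ≈ D)
             (e : ℚ) (0<e : 0ℚ < e) (above : Eventually (λ k → ½ * (seq l k + seq s k) + e ≤ seq μ k)) where

      private
        residual-small : ∀ η → 0ℚ < η → Eventually (λ k →
          ∀ j → residual (rationalAlpha G (seq α k)) (seq μ k) (λ i → seq (x i) k) j < η)
        residual-small η 0<η = allᴱ λ j → mapᴱ (λ k → subst (λ q → ∣ q - seq μ k * seq (x j) k ∣ < η)
          (≡.trans (seq-sum (λ i → alphaMatrix G α j i *ℝ x i) k)
            (sum-cong-≗ λ i → cong (_* seq (x i) k) (seq-alphaMatrix α j i k)))) (eigen j η 0<η)

      -- The order of the choices matters: `K` depends on μ and l alone, and η on `K`, `e` and ε.
      -- With both fixed, all requirements of `entries-small` hold from a common index on.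
      eigenvector-null : ∀ i → x i ≈ 0ℝ
      eigenvector-null i ε 0<ε =
        let K , 0<K , ≤K = bounded (μ -ℝ l)
            η , 0<η , ηT≡ = tolerance e K ε 0<e 0<K 0<ε
        in mapᴱ
          (λ { k (α≤1 , above , -½e≤s , disc≤ , ≤K , res) →
            subst (λ q → ∣ q ∣ < ε) (sym (ℚ.+-identityʳ (seq (x i) k)))
              (entries-small e K ε 0<e 0<K 0<ε 0<η ηT≡ {x = λ i → seq (x i) k}
                (0≤α k) (l≡ k) (D≡ k) α≤1 above -½e≤s disc≤ ≤K res i) })
          (α≤1 ∧ᴱ (above ∧ᴱ (0≤ℝ⇒eventually {s} 0≤s (½ * e) (0<* 0<½ 0<e)
            ∧ᴱ (s² (e * e) (0<* 0<e 0<e) ∧ᴱ (≤K ∧ᴱ residual-small η 0<η)))))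

  -- Changing the representative of α

  module _ {n t δ : ℕ} {α α′ : ℝ} (α≈ : α ≈ α′) where

    private
      *α : ∀ y → α *ℝ y ≈ α′ *ℝ y
      *α y = *ℝ-cong {α} {α′} {y} {y} α≈ (≈-refl {y})

      1-α : 1ℝ -ℝ α ≈ 1ℝ -ℝ α′
      1-α = -ℝ-cong {1ℝ} {1ℝ} {α} {α′} (≈-refl {1ℝ}) α≈

    linearTerm-cong : linearTerm n δ α ≈ linearTerm n δ α′
    linearTerm-cong =
      -ℝ-cong {fromℕ δ +ℝ α *ℝ fromℕ n -ℝ α *ℝ fromℕ δ} {fromℕ δ +ℝ α′ *ℝ fromℕ n -ℝ α′ *ℝ fromℕ δ} {1ℝ} {1ℝ}
        (-ℝ-cong {fromℕ δ +ℝ α *ℝ fromℕ n} {fromℕ δ +ℝ α′ *ℝ fromℕ n} {α *ℝ fromℕ δ} {α′ *ℝ fromℕ δ}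
          (+ℝ-cong {fromℕ δ} {fromℕ δ} {α *ℝ fromℕ n} {α′ *ℝ fromℕ n} (≈-refl {fromℕ δ}) (*α (fromℕ n)))
          (*α (fromℕ δ)))
        (≈-refl {1ℝ})

    discriminant-cong : discriminant n t δ α ≈ discriminant n t δ α′
    discriminant-cong =
      +ℝ-cong {linearTerm n δ α *ℝ linearTerm n δ α} {linearTerm n δ α′ *ℝ linearTerm n δ α′}
              {fromℕ 4 *ℝ (1ℝ -ℝ α) *ℝ C} {fromℕ 4 *ℝ (1ℝ -ℝ α′) *ℝ C}
        (*ℝ-cong {linearTerm n δ α} {linearTerm n δ α′} {linearTerm n δ α} {linearTerm n δ α′}
          linearTerm-cong linearTerm-cong)
        (*ℝ-cong {fromℕ 4 *ℝ (1ℝ -ℝ α)} {fromℕ 4 *ℝ (1ℝ -ℝ α′)} {C} {C}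
          (*ℝ-cong {fromℕ 4} {fromℕ 4} {1ℝ -ℝ α} {1ℝ -ℝ α′} (≈-refl {fromℕ 4}) 1-α) (≈-refl {C}))
      where
      C : ℝ
      C = fromℕ 2 *ℝ fromℕ (h₀ n t δ) -ℝ fromℕ n *ℝ fromℕ δ +ℝ fromℕ δ

    alphaMatrix-cong : ∀ (G : Graph n) i j → alphaMatrix G α i j ≈ alphaMatrix G α′ i j
    alphaMatrix-cong G i j =
      +ℝ-cong {α *ℝ degreeMatrix G i j} {α′ *ℝ degreeMatrix G i j}
              {(1ℝ -ℝ α) *ℝ adjacencyMatrix G i j} {(1ℝ -ℝ α′) *ℝ adjacencyMatrix G i j}
        (*α (degreeMatrix G i j))
        (*ℝ-cong {1ℝ -ℝ α} {1ℝ -ℝ α′} {adjacencyMatrix G i j} {adjacencyMatrix G i j} 1-α (≈-refl {adjacencyMatrix G i j}))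

  above-cong : ∀ {l l′ s μ : ℝ} → l ≈ l′ → ½ℝ *ℝ (l +ℝ s) <ℝ μ →
    Σ[ e ∈ ℚ ] 0ℚ < e × Eventually (λ k → ½ * (seq l′ k + seq s k) + e ≤ seq μ k)
  -- Replacing l by l′ eventually moves ½(l + s) by less than ε/4, so half of the gap survives.
  above-cong {l} {l′} {s} {μ} l≈ (ε , 0<ε , above) = ½ * ε , 0<* 0<½ 0<ε ,
    mapᴱ (λ { k (above , close) → transfer (seq l k) (seq l′ k) (seq s k) (seq μ k) above close })
      (above ∧ᴱ l≈ (½ * ε) (0<* 0<½ 0<ε))
    where
    identity : ∀ b b′ s ε m → m ≡ ½ * (b′ + s) + ½ * ε +
      ((m - (½ * (b + s) + ε)) + ½ * (½ * ε - - (b - b′)) + ½ * (½ * ε))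
    identity = solve-∀ ℚ-ring
    transfer : ∀ b b′ s m → ½ * (b + s) + ε ≤ m → ∣ b - b′ ∣ < ½ * ε → ½ * (b′ + s) + ½ * ε ≤ m
    transfer b b′ s m above close = gap⇒≤
      ((m - (½ * (b + s) + ε)) + ½ * (½ * ε - - (b - b′)) + ½ * (½ * ε))
      (0≤+ (0≤+ (≤⇒gap above) (0≤* (ℚ.<⇒≤ 0<½) (≤⇒gap near))) (0≤* (ℚ.<⇒≤ 0<½) (ℚ.<⇒≤ (0<* 0<½ 0<ε))))
      (identity b b′ s ε m)
      where
      near : - (b - b′) ≤ ½ * ε
      near = ℚ.≤-trans (p≤∣p∣ (- (b - b′))) (ℚ.≤-trans (ℚ.≤-reflexive (ℚ.∣-p∣≡∣p∣ (b - b′))) (ℚ.<⇒≤ close))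

  seq-linearTerm : ∀ n δ α k → seq (linearTerm n δ α) k ≡ ι δ + seq α k * ι n - seq α k * ι δ - 1ℚ
  seq-linearTerm n δ α k = refl

  seq-discriminant : ∀ n t δ α k → seq (discriminant n t δ α) k ≡
    seq (linearTerm n δ α) k * seq (linearTerm n δ α) k +
    ι 4 * (1ℚ - seq α k) * (ι 2 * ι (h₀ n t δ) - ι n * ι δ + ι δ)
  seq-discriminant n t δ α k = refl

  eventually≤1 : ∀ {x} → x <ℝ 1ℝ → Eventually (λ k → seq x k ≤ 1ℚ)
  eventually≤1 {x} (ε , 0<ε , x+ε≤1) = mapᴱ
    (λ k → ℚ.≤-trans (gap⇒≤ {seq x k} ε (ℚ.<⇒≤ 0<ε) refl)) x+ε≤1

  positivePart≤1 : ∀ {x} → Eventually (λ k → seq x k ≤ 1ℚ) → Eventually (λ k → seq (positivePart x) k ≤ 1ℚ)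
  positivePart≤1 = mapᴱ (λ k x≤1 → ℚ.⊔-lub x≤1 (ℚ.nonNegative⁻¹ 1ℚ))

  eigen-cong : ∀ {n} (M N : Matrix n) → (∀ i j → M i j ≈ N i j) → (μ : ℝ) (x : Fin n → ℝ) →
    (∀ i → sum (λ j → M i j *ℝ x j) ≈ μ *ℝ x i) → ∀ i → sum (λ j → N i j *ℝ x j) ≈ μ *ℝ x i
  eigen-cong M N M≈N μ x eigen i =
    ≈-trans {sum (λ j → N i j *ℝ x j)} {sum (λ j → M i j *ℝ x j)} {μ *ℝ x i}
      (sum-cong {f = λ j → N i j *ℝ x j} {λ j → M i j *ℝ x j} λ j →
        *ℝ-cong {N i j} {M i j} {x j} {x j} (≈-sym {M i j} {N i j} (M≈N i j)) (≈-refl {x j}))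
      (eigen i)

  -- The representative α′ of α is nonnegative at every index, which makes
  -- A_α entrywise nonnegative there.
  module _ {n t δ : ℕ} (4≤2t : 4 ℕ.≤ 2 ℕ.* t) (2t≤δ : 2 ℕ.* t ℕ.≤ δ) (δ≤h : δ ℕ.≤ h n t)
           (α α′ : ℝ) (α≈ : α ≈ α′) (0≤α′ : ∀ k → 0ℚ ≤ seq α′ k) (α′≤1 : Eventually (λ k → seq α′ k ≤ 1ℚ))
           (G : Graph n) (δ≤ : ∀ z → δ ℕ.≤ degree G z) (μ : ℝ) (x : Fin n → ℝ)
           (eigen : ∀ i → sum (λ j → alphaMatrix G α i j *ℝ x j) ≈ μ *ℝ x i)
           (s : ℝ) (0≤s : 0ℝ ≤ℝ s) (s² : s *ℝ s ≈ discriminant n t δ α)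
           (above : ½ℝ *ℝ (linearTerm n δ α +ℝ s) <ℝ μ) (small : ΣDegree G ℕ.≤ 2 ℕ.* h₀ n t δ) where

    private
      eigen′ : ∀ i → sum (λ j → alphaMatrix G α′ i j *ℝ x j) ≈ μ *ℝ x i
      eigen′ = eigen-cong (alphaMatrix G α) (alphaMatrix G α′) (alphaMatrix-cong {n} {t} {δ} {α} {α′} α≈ G) μ x eigen

      s²′ : s *ℝ s ≈ discriminant n t δ α′
      s²′ = ≈-trans {s *ℝ s} {discriminant n t δ α} {discriminant n t δ α′} s²
        (discriminant-cong {n} {t} {δ} {α} {α′} α≈)

      above′ : Σ[ e ∈ ℚ ] 0ℚ < e × Eventually (λ k → ½ * (seq (linearTerm n δ α′) k + seq s k) + e ≤ seq μ k)
      above′ = above-cong {linearTerm n δ α} {linearTerm n δ α′} {s} {μ} (linearTerm-cong {n} {t} {δ} {α} {α′} α≈) above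

    small⇒null : ∀ i → x i ≈ 0ℝ
    small⇒null = let e , 0<e , above″ = above′ in
      eigenvector-null {t = t} G δ≤ (nδ≤2h₀ {n} {t} {δ} 4≤2t 2t≤δ δ≤h) small α′
        (linearTerm n δ α′) (discriminant n t δ α′) μ s x
        0≤α′ α′≤1 (seq-linearTerm n δ α′) (seq-discriminant n t δ α′) eigen′ 0≤s s²′ e 0<e above″

  module _ {n t δ : ℕ} (4≤2t : 4 ℕ.≤ 2 ℕ.* t) (2t≤δ : 2 ℕ.* t ℕ.≤ δ) (δ≤h : δ ℕ.≤ h n t) where

    spectral-radius⇒size : ∀ {α} → 0ℝ ≤ℝ α → α <ℝ 1ℝ → (G : Graph n) → HasMinDegree G δ →
      ∀ {μ} → IsEigenvalue (alphaMatrix G α) μ → ∀ {s} → IsSqrt (discriminant n t δ α) s →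
      ½ℝ *ℝ (linearTerm n δ α +ℝ s) <ℝ μ → 2 ℕ.* h₀ n t δ ℕ.< ΣDegree G
    spectral-radius⇒size {α} 0≤α α<1 G (δ≤ , _) {μ} (x , x≉0 , eigen) {s} (0≤s , s²) above =
      -- The order of natural numbers is decidable and `x≉0` is itself a negation, so it is enough
      -- to refute the opposite inequality.
      ℕ.≰⇒> λ small → x≉0 (small⇒null 4≤2t 2t≤δ δ≤h α (positivePart α) (positivePart-≈ {α} 0≤α)
        (λ k → ℚ.p≤q⊔p (seq α k) 0ℚ) (positivePart≤1 {α} (eventually≤1 {α} α<1)) G δ≤ μ x eigen s 0≤s s² above small)

open import Data.Nat.Base using (ℕ; _≤_; _*_)

corollary2p11 : (n t δ : ℕ) → 3 ≤ n → 4 ≤ 2 * t → 2 * t ≤ δ → δ ≤ h n t →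
    (α : ℝ) → 0ℝ ≤ℝ α → α <ℝ 1ℝ →
    (G : Graph n) → Connected G → HasMinDegree G δ →
    (λ₁ : ℝ) → IsLargestEigenvalue (alphaMatrix G α) λ₁ →
    (s : ℝ) → IsSqrt (discriminant n t δ α) s →
    ½ℝ *ℝ (linearTerm n δ α +ℝ s) <ℝ λ₁ →
    ManyToManyDisjointPathCoverable G t
corollary2p11 n t δ _ 4≤2t 2t≤δ δ≤h α 0≤α α<1 G _ minDegree λ₁ (eigenvalue , _) s sqrt above =
  Combinatorics.size⇒coverable 4≤2t 2t≤δ G minDegree
    (Spectral.spectral-radius⇒size 4≤2t 2t≤δ δ≤h {α} 0≤α α<1 G minDegree {λ₁} eigenvalue {s} sqrt above)
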